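{- For all integers $m,n\ge 0$, $b_0(m,n)\ge b_0(m+2,n)$.
   Context: A plane partition $\pi=(\pi_{i,j})_{i,j\ge 1}$ is an array of nonnegative integers, only finitely many nonzero, with $\pi_{i,j}\ge\pi_{i+a,j+b}$ for all $i,j\ge1$, $a,b\ge 0$. Let $w_-(\pi)=\sum_{i<j}\pi_{i,j}$, $w_0(\pi)=\sum_{i=j}\pi_{i,j}$, $w_+(\pi)=\sum_{i>j}\pi_{i,j}$ and $w(\pi)=w_-(\pi)+w_0(\pi)+w_+(\pi)$. For integers $\ell$ and $n\ge 0$, $b_0(\ell,n)$ is the number of plane partitions $\pi$ with $w(\pi)=n$ and $w_-(\pi)-w_+(\pi)=\ell$. -}

module Defs where

open import Data.Nat using (ℕ; zero; suc; _+_; _≤_; _<ᵇ_; _≡ᵇ_)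
import Data.Nat.Properties as ℕP
open import Data.Integer as ℤ using (ℤ; +_; _-_)
import Data.Integer.Properties as ℤP
open import Data.Fin using (Fin; toℕ)
open import Data.Fin.Properties using (all?)
open import Data.Vec using (Vec; []; _∷_; lookup)
open import Data.Nat.ListAction using (sum)
open import Data.List using (List; []; _∷_; map; concatMap; length; filter; upTo; allFin)
open import Data.Bool using (if_then_else_)
open import Data.Product using (_×_)
open import Relation.Binary.PropositionalEquality using (_≡_)
open import Relation.Nullary using (Dec)
open import Relation.Nullary.Decidable using (_×-dec_; _→-dec_)

-- An n×n array of naturals (rows indexed by i, columns by j, 0-based).
-- Entries outside the box are implicitly 0.
Array : ℕ → Set
Array n = Vec (Vec ℕ n) n

entry : ∀ {n} → Array n → Fin n → Fin n → ℕ
entry A i j = lookup (lookup A i) j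

IsPlanePartition : ∀ {n} → Array n → Set
IsPlanePartition {n} A =
  (i j i' j' : Fin n) → toℕ i ≤ toℕ i' → toℕ j ≤ toℕ j' → entry A i' j' ≤ entry A i j

isPlanePartition? : ∀ {n} (A : Array n) → Dec (IsPlanePartition A)
isPlanePartition? A =
  all? λ i → all? λ j → all? λ i' → all? λ j' →
    (toℕ i ℕP.≤? toℕ i') →-dec ((toℕ j ℕP.≤? toℕ j') →-dec (entry A i' j' ℕP.≤? entry A i j))

sumWhere : ∀ {n} → (ℕ → ℕ → Data.Bool.Bool) → Array n → ℕ
sumWhere {n} c A =
  sum (map (λ i → sum (map (λ j → if c (toℕ i) (toℕ j) then entry A i j else 0) (allFin n))) (allFin n))

wMinus w0 wPlus w : ∀ {n} → Array n → ℕ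
wMinus = sumWhere (λ i j → i <ᵇ j)
w0     = sumWhere (λ i j → i ≡ᵇ j)
wPlus  = sumWhere (λ i j → j <ᵇ i)
w A = wMinus A + w0 A + wPlus A

allVecs : ∀ {a} {X : Set a} → List X → (k : ℕ) → List (Vec X k)
allVecs xs zero = [] ∷ []
allVecs xs (suc k) = concatMap (λ x → map (x ∷_) (allVecs xs k)) xs

allArrays : (n : ℕ) → List (Array n)
allArrays n = allVecs (allVecs (upTo (suc n)) n) n

Counted : ℤ → (n : ℕ) → Array n → Set
Counted ℓ n A = IsPlanePartition A × (w A ≡ n) × ((+ wMinus A) - (+ wPlus A) ≡ ℓ)

counted? : ∀ ℓ n (A : Array n) → Dec (Counted ℓ n A)
counted? ℓ n A = isPlanePartition? A ×-dec ((w A ℕP.≟ n) ×-dec ((+ wMinus A) - (+ wPlus A) ℤP.≟ ℓ))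

-- b₀(ℓ,n): number of plane partitions π with w(π)=n and w₋(π)−w₊(π)=ℓ.
-- A plane partition of weight n has all nonzero entries in the n×n box
-- (indices i,j ≤ n in 1-based terms) and all entries ≤ n, so it is exactly
-- one of the arrays in allArrays n.
b₀ : ℤ → ℕ → ℕ
b₀ ℓ n = length (filter (counted? ℓ n) (allArrays n))

{-# OPTIONS --safe #-}
module Submission where

-- By RSK, plane partitions π correspond to multisets of letters (a , b) ∈ ℕ × ℕ, where a letter
-- contributes a to w₊, b to w₋ and 1 to w₀.  Hence b₀(m,n) is the dimension of the weight-m space
-- of the sl₂-module formed by the degree-n part of Sym (⊕ₖ Vₖ), with Vₖ of dimension 1 + k placed
-- in degree 1 + k, and an sl₂-module has dim (weight m) ≥ dim (weight m + 2) for m ≥ 0: the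
-- operator moving weight m + 2 to weight m is injective.  Symmetric powers are modelled by the
-- functions on words that are invariant under permutation.

open import Defs
open import Data.Nat as ℕ using (ℕ; zero; suc; pred; z≤n; s≤s)
import Data.Nat.Properties as ℕP
import Data.Nat.ListAction as ListAction
import Data.Nat.Tactic.RingSolver as ℕSolver
open import Data.Integer as ℤ using (ℤ; 0ℤ; 1ℤ)
import Data.Integer.Properties as ℤP
import Data.Integer.Tactic.RingSolver as ℤSolver
open import Data.Bool using (if_then_else_)
open import Data.Fin using (Fin; zero; suc; toℕ; fromℕ<; punchIn)
open import Data.Fin.Properties using (any?; punchInᵢ≢i; toℕ-fromℕ<)
open import Data.List as List
  using (List; []; _∷_; _++_; concat; concatMap; applyUpTo; replicate; allFin; length; upTo; cartesianProductWith; filter)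
open import Data.List.Properties using (map-tabulate)
open import Data.List.Membership.Propositional using (_∈_)
open import Data.List.Membership.Propositional.Properties
  using (∈-cartesianProductWith⁺; ∈-upTo⁺; ∈-filter⁺; ∈-filter⁻; ∈-lookup)
open import Data.List.Relation.Binary.Permutation.Propositional
  using (_↭_; prep; swap; ↭-refl; ↭-sym; ↭-trans)
open import Data.List.Relation.Unary.All as All using (All; []; _∷_)
import Data.List.Relation.Unary.All.Properties as AllP
open import Data.List.Relation.Unary.AllPairs using ([]; _∷_)
open import Data.List.Relation.Unary.Any using (index; here)
open import Data.List.Relation.Unary.Any.Properties using (lookup-index)
open import Data.List.Relation.Unary.Unique.Propositional using (Unique)
open import Data.List.Relation.Unary.Unique.Propositional.Properties using (cartesianProductWith⁺; upTo⁺; filter⁺)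
open import Data.Product using (∃; _×_; _,_; proj₁; proj₂)
open import Data.Sum using (_⊎_; inj₁; inj₂)
open import Data.Unit using (tt)
open import Data.Vec as Vec using (Vec; []; _∷_; lookup)
open import Data.Vec.Functional using (insertAt)
open import Data.Vec.Functional.Properties using (insertAt-lookup; insertAt-punchIn)
open import Data.Vec.Properties using (lookup∘tabulate; tabulate∘lookup; tabulate-cong; ≡-dec; ∷-injective)
open import Function using (_∘_; _$_)
open import Relation.Binary.PropositionalEquality
open import Relation.Nullary using (Dec; does; ¬_; yes; no; ¬?; contradiction)
open import Relation.Nullary.Decidable using (_×-dec_; dec-true; dec-false; decidable-stable)
open import Algebra.Properties.AbelianGroup ℤP.+-0-abelianGroup using (∙-cancelʳ)
import Algebra.Properties.Semiring.Sum ℕP.+-*-semiring as ΣP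
open import Algebra.Properties.Semiring.Sum ℤP.+-*-semiring
  using (sum; sum-cong-≗; sum-replicate-zero; sum-remove; ∑-distrib-+; *-distribʳ-sum)

open ≡-Reasoning

-- Growth diagrams and RSK

-- RSK is used through its local growth rule: at each cell one corner partition is a function of the
-- other three and of the content, built from min, max and addition, and the rule can be solved from
-- either end. From the far corner it turns multiplicities of letters into a diagram; from the axes
-- it recovers multiplicities from the diagonals of a plane partition. Both diagrams satisfy the
-- same equations, so bijectivity becomes uniqueness of a solution with given contents or with given
-- boundary.
--
-- For injectivity, a function `φ` of weight `λ > 0` killed by `lower` is a lowest weight vector,
-- and applying `lower` to its (k+1)-st raising gives the k-th raising times `-(k+1)(λ+k)`. Weight
-- is at most degree, so sufficiently high raisings vanish; the coefficients are nonzero, so the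
-- vanishing descends to `φ`. Only cancellation is involved, hence integer coefficients suffice, and
-- counting dimensions amounts to an integer relation between the rows of the matrix of `lower`.

module _ where

  open import Data.Nat using (_+_; _*_; _∸_; _≤_; _<_; _⊓_; _⊔_; _<ᵇ_; _≡ᵇ_)

  -- Finite sums of naturals

  ∑ : ℕ → (ℕ → ℕ) → ℕ
  ∑ n f = ΣP.sum {n} (f ∘ toℕ)

  ∑-cong : ∀ n {f g} → (∀ i → f i ≡ g i) → ∑ n f ≡ ∑ n g
  ∑-cong n f≗g = ΣP.sum-cong-≗ {n} (f≗g ∘ toℕ)

  ∑-+ : ∀ n f g → ∑ n (λ i → f i + g i) ≡ ∑ n f + ∑ n g
  ∑-+ n f g = ΣP.∑-distrib-+ {n} (f ∘ toℕ) (g ∘ toℕ)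

  ∑-zero : ∀ n {f} → (∀ i → f i ≡ 0) → ∑ n f ≡ 0
  ∑-zero n f≗0 = trans (∑-cong n f≗0) (ΣP.sum-replicate-zero n)

  ∑-suc-last : ∀ n f → ∑ (suc n) f ≡ ∑ n f + f n
  ∑-suc-last zero    f = ℕP.+-comm (f 0) 0
  ∑-suc-last (suc n) f =
    trans (cong (f 0 +_) (∑-suc-last n (f ∘ suc))) (sym (ℕP.+-assoc (f 0) (∑ n (f ∘ suc)) (f (suc n))))

  ∑-extend : ∀ n f → f n ≡ 0 → ∑ (suc n) f ≡ ∑ n f
  ∑-extend n f fn≡0 = trans (∑-suc-last n f) (trans (cong (∑ n f +_) fn≡0) (ℕP.+-identityʳ (∑ n f)))

  m⊓n+m⊔n≡m+n : ∀ m n → (m ⊓ n) + (m ⊔ n) ≡ m + n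
  m⊓n+m⊔n≡m+n zero    n       = refl
  m⊓n+m⊔n≡m+n (suc m) zero    = sym (ℕP.+-identityʳ (suc m))
  m⊓n+m⊔n≡m+n (suc m) (suc n) = cong suc $ begin
    (m ⊓ n) + suc (m ⊔ n)   ≡⟨ ℕP.+-suc (m ⊓ n) (m ⊔ n) ⟩
    suc ((m ⊓ n) + (m ⊔ n)) ≡⟨ cong suc (m⊓n+m⊔n≡m+n m n) ⟩
    suc (m + n)             ≡⟨ ℕP.+-suc m n ⟨
    m + suc n               ∎

  -- Interlacing, toggles and growth diagrams

  infix 4 _≽_

  -- Interlacing: α/β is a horizontal strip. The chain `α (suc r) ≤ β r ≤ α r` also makes both
  -- sequences weakly decreasing, so being a partition is not stated separately.
  _≽_ : (ℕ → ℕ) → (ℕ → ℕ) → Set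
  α ≽ β = ∀ r → β r ≤ α r × α (suc r) ≤ β r

  -- The reflection of the interval from `lo` to `hi`, as in Bender-Knuth involutions; the truncated
  -- subtraction is exact for `x` in the interval.
  toggle : ℕ → ℕ → ℕ → ℕ
  toggle lo hi x = hi + lo ∸ x

  module _ {lo hi x : ℕ} (lo≤x : lo ≤ x) (x≤hi : x ≤ hi) where

    toggle-+ : toggle lo hi x + x ≡ hi + lo
    toggle-+ = ℕP.m∸n+n≡m (ℕP.≤-trans x≤hi (ℕP.m≤m+n hi lo))

    lo≤toggle : lo ≤ toggle lo hi x
    lo≤toggle = ℕP.m+n≤o⇒m≤o∸n lo (subst (_≤ hi + lo) (ℕP.+-comm x lo) (ℕP.+-monoˡ-≤ lo x≤hi))

    toggle≤hi : toggle lo hi x ≤ hi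
    toggle≤hi = ℕP.m≤n+o⇒m∸n≤o (hi + lo) x (subst (_≤ x + hi) (ℕP.+-comm lo hi) (ℕP.+-monoˡ-≤ hi lo≤x))

  -- The growth diagram of RSK: the partition M i j sits at the lattice point (i , j), and A i j is
  -- the content of the cell with corners (i , j) and (1 + i , 1 + j).  The partitions M 0 j and
  -- M i 0 along the boundary will be the diagonals of a plane partition.
  record Growth (n : ℕ) (A : ℕ → ℕ → ℕ) (M : ℕ → ℕ → ℕ → ℕ) : Set where
    field
      vanishʳ : ∀ i j r → n ≤ r + i → M i j r ≡ 0
      vanishᶜ : ∀ i j r → n ≤ r + j → M i j r ≡ 0
      ≽ʳ      : ∀ i j → M i j ≽ M (suc i) j
      ≽ᶜ      : ∀ i j → M i j ≽ M i (suc j)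
      first   : ∀ i j → M i j 0 ≡ (M (suc i) j 0 ⊔ M i (suc j) 0) + A i j
      rest    : ∀ i j r → M i j (suc r) + M (suc i) (suc j) r
                        ≡ (M (suc i) j r ⊓ M i (suc j) r) + (M (suc i) j (suc r) ⊔ M i (suc j) (suc r))

    -- Sum of `first` and all the equations `rest`. These pair part `suc r` of the near corner with
    -- part `r` of the far one, so one extra part, zero by `vanishʳ`, is appended to align the
    -- indices; min and max then recombine to a plain sum.
    ∑-local : ∀ i j → ∑ n (M i j) + ∑ n (M (suc i) (suc j))
                    ≡ ∑ n (M (suc i) j) + ∑ n (M i (suc j)) + A i j
    ∑-local i j = begin
      ∑ n ν + ∑ n κ
        ≡⟨ cong (_+ ∑ n κ) (∑-extend n ν (vanishʳ i j n (ℕP.m≤m+n n i))) ⟨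
      ν 0 + ∑ n (ν ∘ suc) + ∑ n κ
        ≡⟨ ℕP.+-assoc (ν 0) (∑ n (ν ∘ suc)) (∑ n κ) ⟩
      ν 0 + (∑ n (ν ∘ suc) + ∑ n κ)
        ≡⟨ cong₂ _+_ (first i j) (trans (sym (∑-+ n (ν ∘ suc) κ)) (trans (∑-cong n (rest i j)) (∑-+ n low (high ∘ suc)))) ⟩
      high 0 + A i j + (∑ n low + ∑ n (high ∘ suc))
        ≡⟨ lem (high 0) (A i j) (∑ n low) (∑ n (high ∘ suc)) ⟩
      ∑ n low + ∑ (suc n) high + A i j
        ≡⟨ cong (λ x → ∑ n low + x + A i j) (∑-extend n high
             (cong₂ _⊔_ (vanishʳ (suc i) j n (ℕP.m≤m+n n (suc i))) (vanishʳ i (suc j) n (ℕP.m≤m+n n i)))) ⟩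
      ∑ n low + ∑ n high + A i j
        ≡⟨ cong (_+ A i j) (trans (sym (∑-+ n low high)) (trans (∑-cong n λ r → m⊓n+m⊔n≡m+n (α r) (β r)) (∑-+ n α β))) ⟩
      ∑ n α + ∑ n β + A i j ∎
      where
      ν = M i j
      α = M (suc i) j
      β = M i (suc j)
      κ = M (suc i) (suc j)
      low high : ℕ → ℕ
      low  r = α r ⊓ β r
      high r = α r ⊔ β r
      lem : ∀ h a l s → h + a + (l + s) ≡ l + (h + s) + a
      lem = ℕSolver.solve-∀

  -- Uniqueness of growth diagrams

  open Growth

  -- `first` and `rest` express the near corner of a cell through the other corners and the content,
  -- so induction runs inwards from the far edges.
  growth-≡-contents : ∀ {n A B M N} → Growth n A M → Growth n B N → (∀ i j → A i j ≡ B i j) →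
                      ∀ i j r → M i j r ≡ N i j r
  growth-≡-contents {n} {A} {B} {M} {N} G H A≗B i j = go n n (ℕP.m≤m+n n i) (ℕP.m≤m+n n j)
    where
    -- `k` and `l` bound the distances to the far edges; at distance 0 both partitions are empty.
    go : ∀ k l {i j} → n ≤ k + i → n ≤ l + j → ∀ r → M i j r ≡ N i j r
    go zero l {i} {j} n≤i n≤ r = trans (vanishʳ G i j r n≤ri) (sym (vanishʳ H i j r n≤ri))
      where n≤ri = ℕP.≤-trans n≤i (ℕP.m≤n+m i r)
    go (suc k) zero {i} {j} n≤ n≤j r = trans (vanishᶜ G i j r n≤rj) (sym (vanishᶜ H i j r n≤rj))
      where n≤rj = ℕP.≤-trans n≤j (ℕP.m≤n+m j r)
    go (suc k) (suc l) {i} {j} n≤ n≤′ = λ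
      { zero → trans (first G i j) (trans (cong₂ _+_ (cong₂ _⊔_ (α 0) (β 0)) (A≗B i j)) (sym (first H i j)))
      ; (suc r) → ℕP.+-cancelʳ-≡ (M (suc i) (suc j) r) _ _ (begin
          M i j (suc r) + M (suc i) (suc j) r
            ≡⟨ rest G i j r ⟩
          (M (suc i) j r ⊓ M i (suc j) r) + (M (suc i) j (suc r) ⊔ M i (suc j) (suc r))
            ≡⟨ cong₂ _+_ (cong₂ _⊓_ (α r) (β r)) (cong₂ _⊔_ (α (suc r)) (β (suc r))) ⟩
          (N (suc i) j r ⊓ N i (suc j) r) + (N (suc i) j (suc r) ⊔ N i (suc j) (suc r))
            ≡⟨ rest H i j r ⟨
          N i j (suc r) + N (suc i) (suc j) r
            ≡⟨ cong (N i j (suc r) +_) (go k l n≤₁ n≤₂ r) ⟨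
          N i j (suc r) + M (suc i) (suc j) r ∎) }
      where
      n≤₁ : n ≤ k + suc i
      n≤₁ = subst (n ≤_) (sym (ℕP.+-suc k i)) n≤
      n≤₂ : n ≤ l + suc j
      n≤₂ = subst (n ≤_) (sym (ℕP.+-suc l j)) n≤′
      α : ∀ r → M (suc i) j r ≡ N (suc i) j r
      α = go k (suc l) n≤₁ n≤′
      β : ∀ r → M i (suc j) r ≡ N i (suc j) r
      β = go (suc k) l n≤ n≤₂

  module _ {n A B M N} (G : Growth n A M) (H : Growth n B N)
           (row : ∀ j r → M 0 j r ≡ N 0 j r) (col : ∀ i r → M i 0 r ≡ N i 0 r) where

    -- Here `rest` is solved for the far corner instead; since it involves no content, the boundary
    -- alone propagates.
    growth-≡-boundary : ∀ i j r → M i j r ≡ N i j r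
    growth-≡-boundary zero    j       r = row j r
    growth-≡-boundary (suc i) zero    r = col (suc i) r
    growth-≡-boundary (suc i) (suc j) r = ℕP.+-cancelˡ-≡ (M i j (suc r)) _ _ (begin
      M i j (suc r) + M (suc i) (suc j) r
        ≡⟨ rest G i j r ⟩
      (M (suc i) j r ⊓ M i (suc j) r) + (M (suc i) j (suc r) ⊔ M i (suc j) (suc r))
        ≡⟨ cong₂ _+_ (cong₂ _⊓_ (growth-≡-boundary (suc i) j r) (growth-≡-boundary i (suc j) r))
             (cong₂ _⊔_ (growth-≡-boundary (suc i) j (suc r)) (growth-≡-boundary i (suc j) (suc r))) ⟩
      (N (suc i) j r ⊓ N i (suc j) r) + (N (suc i) j (suc r) ⊔ N i (suc j) (suc r))
        ≡⟨ rest H i j r ⟨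
      N i j (suc r) + N (suc i) (suc j) r
        ≡⟨ cong (_+ N (suc i) (suc j) r) (growth-≡-boundary i j (suc r)) ⟨
      M i j (suc r) + N (suc i) (suc j) r ∎)

    contents-≡-boundary : ∀ i j → A i j ≡ B i j
    contents-≡-boundary i j = ℕP.+-cancelˡ-≡ (M (suc i) j 0 ⊔ M i (suc j) 0) _ _ (begin
      (M (suc i) j 0 ⊔ M i (suc j) 0) + A i j  ≡⟨ first G i j ⟨
      M i j 0                                  ≡⟨ growth-≡-boundary i j 0 ⟩
      N i j 0                                  ≡⟨ first H i j ⟩
      (N (suc i) j 0 ⊔ N i (suc j) 0) + B i j
        ≡⟨ cong (_+ B i j) (cong₂ _⊔_ (growth-≡-boundary (suc i) j 0) (growth-≡-boundary i (suc j) 0)) ⟨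
      (M (suc i) j 0 ⊔ M i (suc j) 0) + B i j  ∎)

  -- The growth diagram with given contents

  module _ (A : ℕ → ℕ → ℕ) where

    -- The arguments `k` and `l` are distances from the far edges, which makes the recursion
    -- structural.
    grow : ℕ → ℕ → ℕ → ℕ
    grow zero    l       r       = 0
    grow (suc k) zero    r       = 0
    grow (suc k) (suc l) zero    = (grow k (suc l) 0 ⊔ grow (suc k) l 0) + A k l
    grow (suc k) (suc l) (suc r) =
      toggle (grow k (suc l) (suc r) ⊔ grow (suc k) l (suc r)) (grow k (suc l) r ⊓ grow (suc k) l r) (grow k l r)

    grow-zeroʳ : ∀ k r → grow k 0 r ≡ 0
    grow-zeroʳ zero    r = refl
    grow-zeroʳ (suc k) r = refl

    -- Interlacing of the far corner with its two neighbours places its parts in the toggling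
    -- intervals; the reflected values stay there, which is interlacing for the near corner. Hence
    -- the mutual induction with `grow-≽ᶜ` through `grow-bounds`.
    grow-≽ʳ : ∀ k l → grow (suc k) l ≽ grow k l
    grow-≽ᶜ : ∀ k l → grow k (suc l) ≽ grow k l

    private
      grow-bounds : ∀ k l r → grow k (suc l) (suc r) ⊔ grow (suc k) l (suc r) ≤ grow k l r
                            × grow k l r ≤ grow k (suc l) r ⊓ grow (suc k) l r
      grow-bounds k l r =
        ℕP.⊔-lub (proj₂ (grow-≽ᶜ k l r)) (proj₂ (grow-≽ʳ k l r)) ,
        ℕP.⊓-glb (proj₁ (grow-≽ᶜ k l r)) (proj₁ (grow-≽ʳ k l r))

    grow-≽ʳ k zero    r rewrite grow-zeroʳ k r = z≤n , z≤n
    grow-≽ʳ k (suc l) r = ge r , le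
      where
      ge : ∀ r → grow k (suc l) r ≤ grow (suc k) (suc l) r
      ge zero    = ℕP.≤-trans (ℕP.m≤m⊔n _ _) (ℕP.m≤m+n _ (A k l))
      ge (suc r) = ℕP.≤-trans (ℕP.m≤m⊔n _ _)
        (lo≤toggle (proj₁ (grow-bounds k l r)) (proj₂ (grow-bounds k l r)))
      le : grow (suc k) (suc l) (suc r) ≤ grow k (suc l) r
      le = ℕP.≤-trans (toggle≤hi (proj₁ (grow-bounds k l r)) (proj₂ (grow-bounds k l r))) (ℕP.m⊓n≤m _ _)
    grow-≽ᶜ zero    l r = z≤n , z≤n
    grow-≽ᶜ (suc k) l r = ge r , le
      where
      ge : ∀ r → grow (suc k) l r ≤ grow (suc k) (suc l) r
      ge zero    = ℕP.≤-trans (ℕP.m≤n⊔m _ _) (ℕP.m≤m+n _ (A k l))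
      ge (suc r) = ℕP.≤-trans (ℕP.m≤n⊔m _ _)
        (lo≤toggle (proj₁ (grow-bounds k l r)) (proj₂ (grow-bounds k l r)))
      le : grow (suc k) (suc l) (suc r) ≤ grow (suc k) l r
      le = ℕP.≤-trans (toggle≤hi (proj₁ (grow-bounds k l r)) (proj₂ (grow-bounds k l r))) (ℕP.m⊓n≤n _ _)

    grow-rest : ∀ k l r → grow (suc k) (suc l) (suc r) + grow k l r
                        ≡ (grow k (suc l) r ⊓ grow (suc k) l r) + (grow k (suc l) (suc r) ⊔ grow (suc k) l (suc r))
    grow-rest k l r = toggle-+ (proj₁ (grow-bounds k l r)) (proj₂ (grow-bounds k l r))

    -- A horizontal strip adds at most one nonzero part, so `k` steps from the empty partition leave
    -- at most `k` parts.
    grow-vanishʳ : ∀ k l r → k ≤ r → grow k l r ≡ 0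
    grow-vanishʳ zero    l r       _         = refl
    grow-vanishʳ (suc k) l (suc r) (s≤s k≤r) =
      ℕP.n≤0⇒n≡0 (subst (grow (suc k) l (suc r) ≤_) (grow-vanishʳ k l r k≤r) (proj₂ (grow-≽ʳ k l r)))

    grow-vanishᶜ : ∀ k l r → l ≤ r → grow k l r ≡ 0
    grow-vanishᶜ k zero    r       _         = grow-zeroʳ k r
    grow-vanishᶜ k (suc l) (suc r) (s≤s l≤r) =
      ℕP.n≤0⇒n≡0 (subst (grow k (suc l) (suc r) ≤_) (grow-vanishᶜ k l r l≤r) (proj₂ (grow-≽ᶜ k l r)))

  n∸i≡suc : ∀ {n i} → i < n → n ∸ i ≡ suc (n ∸ suc i)
  n∸i≡suc {n} {i} i<n = ℕP.+-∸-assoc 1 i<n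

  -- Growth starts at the far corner (n , n), beyond which all partitions are empty.
  fromContents : ℕ → (ℕ → ℕ → ℕ) → ℕ → ℕ → ℕ → ℕ
  fromContents n A i j = grow (λ k l → A (n ∸ suc k) (n ∸ suc l)) (n ∸ i) (n ∸ j)

  module _ (n : ℕ) (A : ℕ → ℕ → ℕ) (A-row : ∀ i j → n ≤ i → A i j ≡ 0) (A-col : ∀ i j → n ≤ j → A i j ≡ 0) where

    private
      A′ : ℕ → ℕ → ℕ
      A′ k l = A (n ∸ suc k) (n ∸ suc l)

      M = fromContents n A

      -- A view of `n ∸ i` and `n ∸ suc i` as the patterns on which `grow` computes; the last
      -- equation of `inside` turns the distance back into the index, so that `A′` reads the right
      -- cell.
      data Side (i : ℕ) : Set where
        inside  : ∀ k → n ∸ i ≡ suc k → n ∸ suc i ≡ k → n ∸ suc k ≡ i → Side i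
        outside : n ∸ i ≡ 0 → n ∸ suc i ≡ 0 → n ≤ i → Side i

      side : ∀ i → Side i
      side i with ℕP.<-≤-connex i n
      ... | inj₁ i<n = inside (n ∸ suc i) (n∸i≡suc i<n) refl
                         (trans (cong (n ∸_) (sym (n∸i≡suc i<n))) (ℕP.m∸[m∸n]≡n (ℕP.<⇒≤ i<n)))
      ... | inj₂ n≤i = outside (ℕP.m≤n⇒m∸n≡0 n≤i) (ℕP.m≤n⇒m∸n≡0 (ℕP.m≤n⇒m≤1+n n≤i)) n≤i

      ≽ʳ′ : ∀ i j → M i j ≽ M (suc i) j
      ≽ʳ′ i j with side i
      ... | inside k eq eq′ _ rewrite eq | eq′ = grow-≽ʳ A′ k (n ∸ j)
      ... | outside eq eq′ _  rewrite eq | eq′ = λ r → z≤n , z≤n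

      ≽ᶜ′ : ∀ i j → M i j ≽ M i (suc j)
      ≽ᶜ′ i j with side j
      ... | inside l eq eq′ _ rewrite eq | eq′ = grow-≽ᶜ A′ (n ∸ i) l
      ... | outside eq eq′ _  rewrite eq | eq′ = λ r →
        ℕP.≤-refl , ℕP.≤-trans (ℕP.≤-reflexive (grow-zeroʳ A′ (n ∸ i) (suc r))) z≤n

      first′ : ∀ i j → M i j 0 ≡ (M (suc i) j 0 ⊔ M i (suc j) 0) + A i j
      first′ i j with side i | side j
      ... | outside eq eq′ n≤i | _ rewrite eq | eq′ = sym (A-row i j n≤i)
      ... | inside k eq eq′ _ | outside eqj eqj′ n≤j rewrite eq | eq′ | eqj | eqj′ =
        sym (cong₂ _+_ (cong (_⊔ 0) (grow-zeroʳ A′ k 0)) (A-col i j n≤j))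
      ... | inside k eq eq′ ki | inside l eqj eqj′ lj rewrite eq | eq′ | eqj | eqj′ =
        cong ((grow A′ k (suc l) 0 ⊔ grow A′ (suc k) l 0) +_) (cong₂ A ki lj)

      rest′ : ∀ i j r → M i j (suc r) + M (suc i) (suc j) r
                      ≡ (M (suc i) j r ⊓ M i (suc j) r) + (M (suc i) j (suc r) ⊔ M i (suc j) (suc r))
      rest′ i j r with side i | side j
      ... | outside eq eq′ _ | _ rewrite eq | eq′ = refl
      ... | inside k eq eq′ _ | outside eqj eqj′ _
        rewrite eq | eq′ | eqj | eqj′ | grow-zeroʳ A′ k r | grow-zeroʳ A′ k (suc r) = refl
      ... | inside k eq eq′ _ | inside l eqj eqj′ _ rewrite eq | eq′ | eqj | eqj′ = grow-rest A′ k l r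

    growth-fromContents : Growth n A (fromContents n A)
    growth-fromContents = record
      { vanishʳ = λ i j r n≤ → grow-vanishʳ A′ (n ∸ i) (n ∸ j) r (ℕP.m≤n+o⇒m∸n≤o n i (subst (n ≤_) (ℕP.+-comm r i) n≤))
      ; vanishᶜ = λ i j r n≤ → grow-vanishᶜ A′ (n ∸ i) (n ∸ j) r (ℕP.m≤n+o⇒m∸n≤o n j (subst (n ≤_) (ℕP.+-comm r j) n≤))
      ; ≽ʳ    = ≽ʳ′
      ; ≽ᶜ    = ≽ᶜ′
      ; first = first′
      ; rest  = rest′
      }

  -- The growth diagram with given boundary

  module _ (π : ℕ → ℕ → ℕ) where

    -- The local rule solved for the far corner: as toggling is an involution, the formula is that
    -- of `grow` with the roles of the two opposite corners exchanged. The initial data are the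
    -- superdiagonals of `π` along `i = 0` and its subdiagonals along `j = 0`.
    fromBoundary : ℕ → ℕ → ℕ → ℕ
    fromBoundary zero    j       r = π r (r + j)
    fromBoundary (suc i) zero    r = π (r + suc i) r
    fromBoundary (suc i) (suc j) r =
      toggle (fromBoundary (suc i) j (suc r) ⊔ fromBoundary i (suc j) (suc r))
             (fromBoundary (suc i) j r ⊓ fromBoundary i (suc j) r)
             (fromBoundary i j (suc r))

    fromBoundary-column : ∀ i r → fromBoundary i 0 r ≡ π (r + i) r
    fromBoundary-column zero    r = cong₂ π (sym (ℕP.+-identityʳ r)) (ℕP.+-identityʳ r)
    fromBoundary-column (suc i) r = refl

    contents : ℕ → ℕ → ℕ
    contents i j = fromBoundary i j 0 ∸ (fromBoundary (suc i) j 0 ⊔ fromBoundary i (suc j) 0)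

  module _ (n : ℕ) (π : ℕ → ℕ → ℕ)
           (π-row : ∀ a b → π (suc a) b ≤ π a b) (π-col : ∀ a b → π a (suc b) ≤ π a b)
           (π-out-row : ∀ a b → n ≤ a → π a b ≡ 0) (π-out-col : ∀ a b → n ≤ b → π a b ≡ 0) where

    private
      M = fromBoundary π

      -- On the boundary, monotonicity of `π` along rows and columns is exactly interlacing of
      -- neighbouring diagonals. Inside, toggling preserves it, the value known to lie in the
      -- interval now being part `suc r` of the near corner.
      ≽ʳ′ : ∀ i j → M i j ≽ M (suc i) j
      ≽ᶜ′ : ∀ i j → M i j ≽ M i (suc j)

      bounds : ∀ i j r → M (suc i) j (suc r) ⊔ M i (suc j) (suc r) ≤ M i j (suc r)
                       × M i j (suc r) ≤ M (suc i) j r ⊓ M i (suc j) r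
      bounds i j r =
        ℕP.⊔-lub (proj₁ (≽ʳ′ i j (suc r))) (proj₁ (≽ᶜ′ i j (suc r))) ,
        ℕP.⊓-glb (proj₂ (≽ʳ′ i j r)) (proj₂ (≽ᶜ′ i j r))

      ≽ʳ′ i zero r rewrite fromBoundary-column π i r | fromBoundary-column π i (suc r) | ℕP.+-suc r i =
        π-row (r + i) r , π-col (suc (r + i)) r
      ≽ʳ′ i (suc j) r =
        ℕP.≤-trans (toggle≤hi (proj₁ (bounds i j r)) (proj₂ (bounds i j r))) (ℕP.m⊓n≤n _ _) ,
        ℕP.≤-trans (ℕP.m≤n⊔m _ _) (lo≤toggle (proj₁ (bounds i j r)) (proj₂ (bounds i j r)))
      ≽ᶜ′ zero j r rewrite ℕP.+-suc r j = π-col r (r + j) , π-row r (suc (r + j))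
      ≽ᶜ′ (suc i) j r =
        ℕP.≤-trans (toggle≤hi (proj₁ (bounds i j r)) (proj₂ (bounds i j r))) (ℕP.m⊓n≤m _ _) ,
        ℕP.≤-trans (ℕP.m≤m⊔n _ _) (lo≤toggle (proj₁ (bounds i j r)) (proj₂ (bounds i j r)))

      vanishʳ′ : ∀ i j r → n ≤ r + i → M i j r ≡ 0
      vanishʳ′ i zero    r n≤ = trans (fromBoundary-column π i r) (π-out-row (r + i) r n≤)
      vanishʳ′ i (suc j) r n≤ =
        ℕP.n≤0⇒n≡0 (subst (M i (suc j) r ≤_) (vanishʳ′ i j r n≤) (proj₁ (≽ᶜ′ i j r)))

      vanishᶜ′ : ∀ i j r → n ≤ r + j → M i j r ≡ 0
      vanishᶜ′ zero    j r n≤ = π-out-col r (r + j) n≤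
      vanishᶜ′ (suc i) j r n≤ =
        ℕP.n≤0⇒n≡0 (subst (M (suc i) j r ≤_) (vanishᶜ′ i j r n≤) (proj₁ (≽ʳ′ i j r)))

    growth-fromBoundary : Growth n (contents π) (fromBoundary π)
    growth-fromBoundary = record
      { vanishʳ = vanishʳ′
      ; vanishᶜ = vanishᶜ′
      ; ≽ʳ    = ≽ʳ′
      ; ≽ᶜ    = ≽ᶜ′
      ; first = λ i j → sym (trans (ℕP.+-comm _ (contents π i j))
                  (ℕP.m∸n+n≡m (ℕP.⊔-lub (proj₁ (≽ʳ′ i j 0)) (proj₁ (≽ᶜ′ i j 0)))))
      ; rest  = λ i j r → trans (ℕP.+-comm (M i j (suc r)) _)
                  (toggle-+ (proj₁ (bounds i j r)) (proj₂ (bounds i j r)))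
      }

  -- Words and additive letter statistics

  Letter Word : Set
  Letter = ℕ × ℕ
  Word   = List Letter

  ∑-comm : ∀ m n (f : ℕ → ℕ → ℕ) → ∑ m (λ i → ∑ n (f i)) ≡ ∑ n (λ j → ∑ m (λ i → f i j))
  ∑-comm m n f = ΣP.∑-comm {m} {n} (λ i j → f (toℕ i) (toℕ j))

  tally : (Letter → ℕ) → Word → ℕ
  tally f []      = 0
  tally f (p ∷ w) = f p + tally f w

  size : Letter → ℕ
  size (a , b) = suc (a + b)

  tally-cong : ∀ {P : Letter → Set} {f g} → (∀ p → P p → f p ≡ g p) → ∀ {w} → All P w → tally f w ≡ tally g w
  tally-cong f≗g []         = refl
  tally-cong f≗g (Pp ∷ Pw) = cong₂ _+_ (f≗g _ Pp) (tally-cong f≗g Pw)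

  Bounded : ℕ → Word → Set
  Bounded n = All (λ (a , b) → a < n × b < n)

  bounded : ∀ {n} w → tally size w ≤ n → Bounded n w
  bounded []            _  = []
  bounded ((a , b) ∷ w) ≤n =
    (ℕP.≤-trans (s≤s (ℕP.m≤m+n a b)) (ℕP.m+n≤o⇒m≤o (size (a , b)) ≤n) ,
     ℕP.≤-trans (s≤s (ℕP.m≤n+m b a)) (ℕP.m+n≤o⇒m≤o (size (a , b)) ≤n)) ∷
    bounded w (ℕP.m+n≤o⇒n≤o (size (a , b)) ≤n)

  tally-zero : ∀ w → tally (λ _ → 0) w ≡ 0
  tally-zero []      = refl
  tally-zero (p ∷ w) = tally-zero w

  tally-+ : ∀ f g w → tally (λ p → f p + g p) w ≡ tally f w + tally g w
  tally-+ f g []      = refl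
  tally-+ f g (p ∷ w) =
    trans (cong (f p + g p +_) (tally-+ f g w)) (lem (f p) (g p) (tally f w) (tally g w))
    where
    lem : ∀ a b c d → a + b + (c + d) ≡ a + c + (b + d)
    lem = ℕSolver.solve-∀

  tally-∑ : ∀ n (f : ℕ → Letter → ℕ) w → ∑ n (λ i → tally (f i) w) ≡ tally (λ p → ∑ n (λ i → f i p)) w
  tally-∑ n f []      = ∑-zero n (λ _ → refl)
  tally-∑ n f (p ∷ w) =
    trans (∑-+ n (λ i → f i p) (λ i → tally (f i) w)) (cong (∑ n (λ i → f i p) +_) (tally-∑ n f w))

  tally-mono : ∀ {f g} → (∀ p → f p ≤ g p) → ∀ w → tally f w ≤ tally g w
  tally-mono f≤g []      = z≤n
  tally-mono f≤g (p ∷ w) = ℕP.+-mono-≤ (f≤g p) (tally-mono f≤g w)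

  tally-++ : ∀ f v w → tally f (v ++ w) ≡ tally f v + tally f w
  tally-++ f []      w = refl
  tally-++ f (p ∷ v) w = trans (cong (f p +_) (tally-++ f v w)) (sym (ℕP.+-assoc (f p) (tally f v) (tally f w)))

  tally-replicate : ∀ f k p → tally f (replicate k p) ≡ k * f p
  tally-replicate f zero    p = refl
  tally-replicate f (suc k) p = cong (f p +_) (tally-replicate f k p)

  tally-concat : ∀ f n (ws : ℕ → Word) → tally f (concat (applyUpTo ws n)) ≡ ∑ n (λ i → tally f (ws i))
  tally-concat f zero    ws = refl
  tally-concat f (suc n) ws =
    trans (tally-++ f (ws 0) _) (cong (tally f (ws 0) +_) (tally-concat f n (ws ∘ suc)))

  tally-resp-↭ : ∀ f {v w} → v ↭ w → tally f v ≡ tally f w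
  tally-resp-↭ f _↭_.refl = refl
  tally-resp-↭ f (prep p v↭w) = cong (f p +_) (tally-resp-↭ f v↭w)
  tally-resp-↭ f (swap {xs = v} {ys = w} p q v↭w) =
    trans (cong (λ z → f p + (f q + z)) (tally-resp-↭ f v↭w)) (lem (f p) (f q) (tally f w))
    where
    lem : ∀ x y z → x + (y + z) ≡ y + (x + z)
    lem = ℕSolver.solve-∀
  tally-resp-↭ f (_↭_.trans u↭v v↭w) = trans (tally-resp-↭ f u↭v) (tally-resp-↭ f v↭w)

  -- Counting letters in cells and quadrants

  𝟙[_≤_] 𝟙[_≡_] : ℕ → ℕ → ℕ
  𝟙[ zero  ≤ a     ] = 1
  𝟙[ suc i ≤ zero  ] = 0
  𝟙[ suc i ≤ suc a ] = 𝟙[ i ≤ a ]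
  𝟙[ zero  ≡ zero  ] = 1
  𝟙[ zero  ≡ suc a ] = 0
  𝟙[ suc i ≡ zero  ] = 0
  𝟙[ suc i ≡ suc a ] = 𝟙[ i ≡ a ]

  [≤]-split : ∀ i a → 𝟙[ i ≤ a ] ≡ 𝟙[ i ≡ a ] + 𝟙[ suc i ≤ a ]
  [≤]-split zero    zero    = refl
  [≤]-split zero    (suc a) = refl
  [≤]-split (suc i) zero    = refl
  [≤]-split (suc i) (suc a) = [≤]-split i a

  [≤]-zero : ∀ {i a} → a < i → 𝟙[ i ≤ a ] ≡ 0
  [≤]-zero {suc i} {zero}  _         = refl
  [≤]-zero {suc i} {suc a} (s≤s a<i) = [≤]-zero a<i

  [≡]-zero : ∀ {i a} → a < i → 𝟙[ i ≡ a ] ≡ 0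
  [≡]-zero {suc i} {zero}  _         = refl
  [≡]-zero {suc i} {suc a} (s≤s a<i) = [≡]-zero a<i

  [≤]≤1 : ∀ i a → 𝟙[ i ≤ a ] ≤ 1
  [≤]≤1 zero    a       = ℕP.≤-refl
  [≤]≤1 (suc i) zero    = z≤n
  [≤]≤1 (suc i) (suc a) = [≤]≤1 i a

  [≡]-refl : ∀ i → 𝟙[ i ≡ i ] ≡ 1
  [≡]-refl zero    = refl
  [≡]-refl (suc i) = [≡]-refl i

  [≡]-cases : ∀ i a → 𝟙[ i ≡ a ] ≡ 0 ⊎ i ≡ a
  [≡]-cases zero    zero    = inj₂ refl
  [≡]-cases zero    (suc a) = inj₁ refl
  [≡]-cases (suc i) zero    = inj₁ refl
  [≡]-cases (suc i) (suc a) with [≡]-cases i a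
  ... | inj₁ eq   = inj₁ eq
  ... | inj₂ refl = inj₂ refl

  ∑-[≤] : ∀ {n b} → b ≤ n → ∑ n (λ d → 𝟙[ suc d ≤ b ]) ≡ b
  ∑-[≤] {n}     {zero}  _         = ∑-zero n (λ _ → refl)
  ∑-[≤] {suc n} {suc b} (s≤s b≤n) = cong suc (∑-[≤] b≤n)

  ∑-[≡] : ∀ {n i} (f : ℕ → ℕ) → i < n → ∑ n (λ a → f a * 𝟙[ i ≡ a ]) ≡ f i
  ∑-[≡] {suc n} {zero}  f _ = begin
    f 0 * 1 + ∑ n (λ a → f (suc a) * 0) ≡⟨ cong₂ _+_ (ℕP.*-identityʳ (f 0)) (∑-zero n (λ a → ℕP.*-zeroʳ (f (suc a)))) ⟩
    f 0 + 0                             ≡⟨ ℕP.+-identityʳ (f 0) ⟩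
    f 0                                 ∎
  ∑-[≡] {suc n} {suc i} f (s≤s i<n) = cong₂ _+_ (ℕP.*-zeroʳ (f 0)) (∑-[≡] (f ∘ suc) i<n)

  ∑-[≡]-out : ∀ {n i} (f : ℕ → ℕ) → n ≤ i → ∑ n (λ a → f a * 𝟙[ i ≡ a ]) ≡ 0
  ∑-[≡]-out {zero}          f _         = refl
  ∑-[≡]-out {suc n} {suc i} f (s≤s n≤i) = cong₂ _+_ (ℕP.*-zeroʳ (f 0)) (∑-[≡]-out (f ∘ suc) n≤i)

  count quadrant : ℕ → ℕ → Word → ℕ
  count    i j = tally (λ (a , b) → 𝟙[ i ≡ a ] * 𝟙[ j ≡ b ])
  quadrant i j = tally (λ (a , b) → 𝟙[ i ≤ a ] * 𝟙[ j ≤ b ])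

  module _ {n} (w : Word) (w<n : Bounded n w) where

    count-out-row : ∀ i j → n ≤ i → count i j w ≡ 0
    count-out-row i j n≤i = trans (tally-cong (λ (a , b) (a<n , _) →
      cong (_* 𝟙[ j ≡ b ]) ([≡]-zero (ℕP.≤-trans a<n n≤i))) w<n) (tally-zero w)

    count-out-col : ∀ i j → n ≤ j → count i j w ≡ 0
    count-out-col i j n≤j = trans (tally-cong (λ (a , b) (_ , b<n) →
      trans (cong (𝟙[ i ≡ a ] *_) ([≡]-zero (ℕP.≤-trans b<n n≤j))) (ℕP.*-zeroʳ 𝟙[ i ≡ a ])) w<n) (tally-zero w)

    quadrant-out-row : ∀ i j → n ≤ i → quadrant i j w ≡ 0
    quadrant-out-row i j n≤i = trans (tally-cong (λ (a , b) (a<n , _) →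
      cong (_* 𝟙[ j ≤ b ]) ([≤]-zero (ℕP.≤-trans a<n n≤i))) w<n) (tally-zero w)

    quadrant-out-col : ∀ i j → n ≤ j → quadrant i j w ≡ 0
    quadrant-out-col i j n≤j = trans (tally-cong (λ (a , b) (_ , b<n) →
      trans (cong (𝟙[ i ≤ a ] *_) ([≤]-zero (ℕP.≤-trans b<n n≤j))) (ℕP.*-zeroʳ 𝟙[ i ≤ a ])) w<n) (tally-zero w)

  -- Inclusion-exclusion for quadrants, arranged as the recurrence that `∑-local` gives for sizes of
  -- partitions.
  quadrant-local : ∀ i j w → quadrant i j w + quadrant (suc i) (suc j) w
                           ≡ quadrant (suc i) j w + quadrant i (suc j) w + count i j w
  quadrant-local i j w = begin
    quadrant i j w + quadrant (suc i) (suc j) w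
      ≡⟨ tally-+ _ _ w ⟨
    tally (λ (a , b) → 𝟙[ i ≤ a ] * 𝟙[ j ≤ b ] + 𝟙[ suc i ≤ a ] * 𝟙[ suc j ≤ b ]) w
      ≡⟨ tally-cong (λ (a , b) _ → letter a b) (All.universal (λ _ → tt) w) ⟩
    tally (λ (a , b) → 𝟙[ suc i ≤ a ] * 𝟙[ j ≤ b ] + 𝟙[ i ≤ a ] * 𝟙[ suc j ≤ b ] + 𝟙[ i ≡ a ] * 𝟙[ j ≡ b ]) w
      ≡⟨ tally-+ _ _ w ⟩
    tally (λ (a , b) → 𝟙[ suc i ≤ a ] * 𝟙[ j ≤ b ] + 𝟙[ i ≤ a ] * 𝟙[ suc j ≤ b ]) w + count i j w
      ≡⟨ cong (_+ count i j w) (tally-+ _ _ w) ⟩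
    quadrant (suc i) j w + quadrant i (suc j) w + count i j w ∎
    where
    lem : ∀ x y s t → (s + x) * (t + y) + x * y ≡ x * (t + y) + (s + x) * y + s * t
    lem = ℕSolver.solve-∀
    letter : ∀ a b → 𝟙[ i ≤ a ] * 𝟙[ j ≤ b ] + 𝟙[ suc i ≤ a ] * 𝟙[ suc j ≤ b ]
                   ≡ 𝟙[ suc i ≤ a ] * 𝟙[ j ≤ b ] + 𝟙[ i ≤ a ] * 𝟙[ suc j ≤ b ] + 𝟙[ i ≡ a ] * 𝟙[ j ≡ b ]
    letter a b rewrite [≤]-split i a | [≤]-split j b = lem 𝟙[ suc i ≤ a ] 𝟙[ suc j ≤ b ] 𝟙[ i ≡ a ] 𝟙[ j ≡ b ]

  -- Both sides vanish at the far edges and obey the same recurrence, by `∑-local` and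
  -- `quadrant-local`. This is how the weights of the resulting array are read off the word.
  ∑-growth : ∀ {n M} w → Bounded n w → Growth n (λ i j → count i j w) M →
             ∀ i j → ∑ n (M i j) ≡ quadrant i j w
  ∑-growth {n} {M} w w<n G i j = go n n (ℕP.m≤m+n n i) (ℕP.m≤m+n n j)
    where
    go : ∀ k l {i j} → n ≤ k + i → n ≤ l + j → ∑ n (M i j) ≡ quadrant i j w
    go zero    l {i} {j} n≤i _ = trans
      (∑-zero n (λ r → vanishʳ G i j r (ℕP.≤-trans n≤i (ℕP.m≤n+m i r)))) (sym (quadrant-out-row w w<n i j n≤i))
    go (suc k) zero {i} {j} _ n≤j = trans
      (∑-zero n (λ r → vanishᶜ G i j r (ℕP.≤-trans n≤j (ℕP.m≤n+m j r)))) (sym (quadrant-out-col w w<n i j n≤j))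
    go (suc k) (suc l) {i} {j} n≤ n≤′ = ℕP.+-cancelʳ-≡ (∑ n (M (suc i) (suc j))) _ _ (begin
      ∑ n (M i j) + ∑ n (M (suc i) (suc j))
        ≡⟨ ∑-local G i j ⟩
      ∑ n (M (suc i) j) + ∑ n (M i (suc j)) + count i j w
        ≡⟨ cong (_+ count i j w) (cong₂ _+_ (go k (suc l) n≤₁ n≤′) (go (suc k) l n≤ n≤₂)) ⟩
      quadrant (suc i) j w + quadrant i (suc j) w + count i j w
        ≡⟨ quadrant-local i j w ⟨
      quadrant i j w + quadrant (suc i) (suc j) w
        ≡⟨ cong (quadrant i j w +_) (go k l n≤₁ n≤₂) ⟨
      quadrant i j w + ∑ n (M (suc i) (suc j)) ∎)
      where
      n≤₁ : n ≤ k + suc i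
      n≤₁ = subst (n ≤_) (sym (ℕP.+-suc k i)) n≤
      n≤₂ : n ≤ l + suc j
      n≤₂ = subst (n ≤_) (sym (ℕP.+-suc l j)) n≤′

  quadrant≤size : ∀ i j w → quadrant i j w ≤ tally size w
  quadrant≤size i j = tally-mono λ (a , b) →
    ℕP.≤-trans (ℕP.*-mono-≤ ([≤]≤1 i a) ([≤]≤1 j b)) (s≤s z≤n)

  module _ {n} (w : Word) (w<n : Bounded n w) where

    ∑-quadrant-cols : ∑ n (λ d → quadrant 0 (suc d) w) ≡ tally proj₂ w
    ∑-quadrant-cols = trans (tally-∑ n (λ d (a , b) → 𝟙[ 0 ≤ a ] * 𝟙[ suc d ≤ b ]) w) (tally-cong (λ (a , b) (a<n , b<n) →
      trans (∑-cong n (λ d → ℕP.+-identityʳ 𝟙[ suc d ≤ b ]))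
              (∑-[≤] (ℕP.<⇒≤ b<n))) w<n)

    ∑-quadrant-rows : ∑ n (λ d → quadrant (suc d) 0 w) ≡ tally proj₁ w
    ∑-quadrant-rows = trans (tally-∑ n (λ d (a , b) → 𝟙[ suc d ≤ a ] * 𝟙[ 0 ≤ b ]) w) (tally-cong (λ (a , b) (a<n , b<n) →
      trans (∑-cong n (λ d → ℕP.*-identityʳ 𝟙[ suc d ≤ a ]))
              (∑-[≤] (ℕP.<⇒≤ a<n))) w<n)

  tally-size : ∀ w → tally size w ≡ tally proj₂ w + quadrant 0 0 w + tally proj₁ w
  tally-size []            = refl
  tally-size ((a , b) ∷ w) = trans (cong (suc (a + b) +_) (tally-size w))
    (lem a b (tally proj₂ w) (quadrant 0 0 w) (tally proj₁ w))
    where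
    lem : ∀ a b x y z → 1 + (a + b) + (x + y + z) ≡ b + x + (1 + y) + (a + z)
    lem = ℕSolver.solve-∀

  -- Words up to permutation and their multiplicities

  extract : ∀ a b w → count a b w ≢ 0 → ∃ λ v → w ↭ (a , b) ∷ v
  extract a b []            ≢0 = contradiction refl ≢0
  extract a b ((c , d) ∷ w) ≢0 with [≡]-cases a c | [≡]-cases b d
  ... | inj₂ refl | inj₂ refl = w , ↭-refl
  ... | inj₁ eq   | _         with extract a b w (λ eq′ → ≢0 (cong₂ _+_ (cong (_* 𝟙[ b ≡ d ]) eq) eq′))
  ...   | v , w↭v = (c , d) ∷ v , ↭-trans (prep (c , d) w↭v) (swap (c , d) (a , b) ↭-refl)
  extract a b ((c , d) ∷ w) ≢0 | inj₂ _ | inj₁ eq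
    with extract a b w (λ eq′ → ≢0 (cong₂ _+_ (trans (cong (𝟙[ a ≡ c ] *_) eq) (ℕP.*-zeroʳ 𝟙[ a ≡ c ])) eq′))
  ...   | v , w↭v = (c , d) ∷ v , ↭-trans (prep (c , d) w↭v) (swap (c , d) (a , b) ↭-refl)

  count-head : ∀ a b w → count a b ((a , b) ∷ w) ≡ suc (count a b w)
  count-head a b w rewrite [≡]-refl a | [≡]-refl b = refl

  -- The head of `v` has nonzero count in `w`, so `extract` brings it to the front there; cancelling
  -- it leaves equal counts for the remainders.
  count-≡⇒↭ : ∀ v w → (∀ i j → count i j v ≡ count i j w) → v ↭ w
  count-≡⇒↭ []            []            eq = ↭-refl
  count-≡⇒↭ []            ((a , b) ∷ w) eq with () ← trans (eq a b) (count-head a b w)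
  count-≡⇒↭ ((a , b) ∷ v) w             eq
    with extract a b w (λ eq′ → ℕP.1+n≢0 (trans (sym (count-head a b v)) (trans (eq a b) eq′)))
  ... | u , w↭u = ↭-trans (prep (a , b) (count-≡⇒↭ v u λ i j →
                    ℕP.+-cancelˡ-≡ (𝟙[ i ≡ a ] * 𝟙[ j ≡ b ]) _ _
                      (trans (eq i j) (tally-resp-↭ _ w↭u))))
                    (↭-sym w↭u)

  wordOf : ℕ → (ℕ → ℕ → ℕ) → Word
  wordOf n A = concat (applyUpTo (λ a → concat (applyUpTo (λ b → replicate (A a b) (a , b)) n)) n)

  count-wordOf : ∀ n A → (∀ i j → n ≤ i → A i j ≡ 0) → (∀ i j → n ≤ j → A i j ≡ 0) →
                 ∀ i j → count i j (wordOf n A) ≡ A i j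
  count-wordOf n A A-row A-col i j = trans (begin
    count i j (wordOf n A)
      ≡⟨ tally-concat _ n _ ⟩
    ∑ n (λ a → count i j (concat (applyUpTo (λ b → replicate (A a b) (a , b)) n)))
      ≡⟨ ∑-cong n (λ a → tally-concat _ n (λ b → replicate (A a b) (a , b))) ⟩
    ∑ n (λ a → ∑ n (λ b → count i j (replicate (A a b) (a , b))))
      ≡⟨ ∑-cong n (λ a → ∑-cong n (λ b → trans (tally-replicate _ (A a b) (a , b))
                                                 (sym (ℕP.*-assoc (A a b) 𝟙[ i ≡ a ] 𝟙[ j ≡ b ])))) ⟩
    ∑ n (λ a → ∑ n (λ b → A a b * 𝟙[ i ≡ a ] * 𝟙[ j ≡ b ])) ∎) sift
    where
    sift : ∑ n (λ a → ∑ n (λ b → A a b * 𝟙[ i ≡ a ] * 𝟙[ j ≡ b ])) ≡ A i j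
    sift with ℕP.<-≤-connex j n
    ... | inj₂ n≤j = trans (∑-zero n {λ a → ∑ n (λ b → A a b * 𝟙[ i ≡ a ] * 𝟙[ j ≡ b ])} (λ a → ∑-[≡]-out (λ b → A a b * 𝟙[ i ≡ a ]) n≤j)) (sym (A-col i j n≤j))
    ... | inj₁ j<n = trans (∑-cong n {λ a → ∑ n (λ b → A a b * 𝟙[ i ≡ a ] * 𝟙[ j ≡ b ])} (λ a → ∑-[≡] (λ b → A a b * 𝟙[ i ≡ a ]) j<n)) sift′
      where
      sift′ : ∑ n (λ a → A a j * 𝟙[ i ≡ a ]) ≡ A i j
      sift′ with ℕP.<-≤-connex i n
      ... | inj₁ i<n = ∑-[≡] (λ a → A a j) i<n
      ... | inj₂ n≤i = trans (∑-[≡]-out (λ a → A a j) n≤i) (sym (A-row i j n≤i))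

  bounded-wordOf : ∀ n A → Bounded n (wordOf n A)
  bounded-wordOf n A = AllP.concat⁺ (AllP.applyUpTo⁺₁ _ n λ {a} a<n →
    AllP.concat⁺ (AllP.applyUpTo⁺₁ _ n λ {b} b<n → AllP.replicate⁺ (A a b) (a<n , b<n)))

  -- Arrays as functions on ℕ × ℕ

  at : ∀ {A : Set} {n} → A → Vec A n → ℕ → A
  at d []      k       = d
  at d (x ∷ v) zero    = x
  at d (x ∷ v) (suc k) = at d v k

  module _ {A : Set} (d : A) where

    at-toℕ : ∀ {n} (v : Vec A n) i → at d v (toℕ i) ≡ lookup v i
    at-toℕ (x ∷ v) zero    = refl
    at-toℕ (x ∷ v) (suc i) = at-toℕ v i

    at-out : ∀ {n} (v : Vec A n) {k} → n ≤ k → at d v k ≡ d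
    at-out []      _         = refl
    at-out (x ∷ v) (s≤s n≤k) = at-out v n≤k

    at-replicate : ∀ n k → at d (Vec.replicate n d) k ≡ d
    at-replicate zero    k       = refl
    at-replicate (suc n) zero    = refl
    at-replicate (suc n) (suc k) = at-replicate n k

  -- Reading 0 outside the box lets sums run along diagonals, with indices such as `i + suc d`,
  -- without bounds to carry.
  extend : ∀ {n} → Array n → ℕ → ℕ → ℕ
  extend {n} y i j = at 0 (at (Vec.replicate n 0) y i) j

  module _ {n} (y : Array n) where

    extend-toℕ : ∀ i j → extend y (toℕ i) (toℕ j) ≡ entry y i j
    extend-toℕ i j = trans (cong (λ v → at 0 v (toℕ j)) (at-toℕ (Vec.replicate n 0) y i)) (at-toℕ 0 (lookup y i) j)

    extend-out-row : ∀ i j → n ≤ i → extend y i j ≡ 0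
    extend-out-row i j n≤i =
      trans (cong (λ v → at 0 v j) (at-out (Vec.replicate n 0) y n≤i)) (at-replicate 0 n j)

    extend-out-col : ∀ i j → n ≤ j → extend y i j ≡ 0
    extend-out-col i j n≤j = at-out 0 (at (Vec.replicate n 0) y i) n≤j

  lookup-injective : ∀ {A : Set} {n} (v w : Vec A n) → (∀ i → lookup v i ≡ lookup w i) → v ≡ w
  lookup-injective v w eq = trans (sym (tabulate∘lookup v)) (trans (tabulate-cong eq) (tabulate∘lookup w))

  extend-injective : ∀ {n} (y z : Array n) → (∀ i j → extend y i j ≡ extend z i j) → y ≡ z
  extend-injective y z eq = lookup-injective y z λ i → lookup-injective (lookup y i) (lookup z i) λ j →
    trans (sym (extend-toℕ y i j)) (trans (eq (toℕ i) (toℕ j)) (extend-toℕ z i j))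

  array : ∀ n → (ℕ → ℕ → ℕ) → Array n
  array n π = Vec.tabulate λ i → Vec.tabulate λ j → π (toℕ i) (toℕ j)

  entry-array : ∀ n π i j → entry (array n π) i j ≡ π (toℕ i) (toℕ j)
  entry-array n π i j =
    trans (cong (λ v → lookup v j) (lookup∘tabulate (λ i → Vec.tabulate λ j → π (toℕ i) (toℕ j)) i))
          (lookup∘tabulate (λ j → π (toℕ i) (toℕ j)) j)

  extend-array : ∀ n π → (∀ i j → n ≤ i → π i j ≡ 0) → (∀ i j → n ≤ j → π i j ≡ 0) →
                 ∀ i j → extend (array n π) i j ≡ π i j
  extend-array n π π-row π-col i j with ℕP.<-≤-connex i n | ℕP.<-≤-connex j n
  ... | inj₂ n≤i | _        = trans (extend-out-row (array n π) i j n≤i) (sym (π-row i j n≤i))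
  ... | inj₁ _   | inj₂ n≤j = trans (extend-out-col (array n π) i j n≤j) (sym (π-col i j n≤j))
  ... | inj₁ i<n | inj₁ j<n =
    subst₂ (λ i j → extend (array n π) i j ≡ π i j) (toℕ-fromℕ< i<n) (toℕ-fromℕ< j<n)
      (trans (extend-toℕ (array n π) (fromℕ< i<n) (fromℕ< j<n)) (entry-array n π (fromℕ< i<n) (fromℕ< j<n)))

  -- Weights and diagonals of an array

  sum-allFin : ∀ {n} g f → (∀ (i : Fin n) → g i ≡ f (toℕ i)) → ListAction.sum (List.map g (allFin n)) ≡ ∑ n f
  sum-allFin {n} g f g≗f = trans (cong ListAction.sum (map-tabulate (λ i → i) g)) (go g f g≗f)
    where
    go : ∀ {n} g f → (∀ (i : Fin n) → g i ≡ f (toℕ i)) → ListAction.sum (List.tabulate g) ≡ ∑ n f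
    go {zero}  g f g≗f = refl
    go {suc n} g f g≗f = cong₂ _+_ (g≗f zero) (go (g ∘ suc) (f ∘ suc) (g≗f ∘ suc))

  sumWhere-∑ : ∀ {n} c (y : Array n) →
               sumWhere c y ≡ ∑ n (λ i → ∑ n (λ j → if c i j then extend y i j else 0))
  sumWhere-∑ {n} c y = sum-allFin _ (λ i → ∑ n (λ j → if c i j then extend y i j else 0)) λ i →
    sum-allFin _ (λ j → if c (toℕ i) j then extend y (toℕ i) j else 0) λ j →
    cong (λ x → if c (toℕ i) (toℕ j) then x else 0) (sym (extend-toℕ y i j))

  -- Reindexing by the distance `d` from the diagonal, `j = i + suc d`; the values of `d` that
  -- overshoot the box contribute 0.
  ∑-if-< : ∀ n i (h : ℕ → ℕ) → (∀ j → n ≤ j → h j ≡ 0) →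
           ∑ n (λ j → if i <ᵇ j then h j else 0) ≡ ∑ n (λ d → h (i + suc d))
  ∑-if-< zero    i       h h≡0 = refl
  ∑-if-< (suc n) zero    h h≡0 = sym (∑-extend n (h ∘ suc) (h≡0 (suc n) ℕP.≤-refl))
  ∑-if-< (suc n) (suc i) h h≡0 = trans
    (∑-if-< n i (h ∘ suc) (λ j n≤j → h≡0 (suc j) (s≤s n≤j)))
    (sym (∑-extend n (λ d → h (suc (i + suc d)))
      (h≡0 (suc (i + suc n)) (s≤s (ℕP.≤-trans (ℕP.n≤1+n n) (ℕP.m≤n+m (suc n) i))))))

  ∑-if-≡ : ∀ n i (h : ℕ → ℕ) → (∀ j → n ≤ j → h j ≡ 0) → ∑ n (λ j → if i ≡ᵇ j then h j else 0) ≡ h i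
  ∑-if-≡ zero    i       h h≡0 = sym (h≡0 i z≤n)
  ∑-if-≡ (suc n) zero    h h≡0 = trans (cong (h 0 +_) (∑-zero n (λ _ → refl))) (ℕP.+-identityʳ (h 0))
  ∑-if-≡ (suc n) (suc i) h h≡0 = ∑-if-≡ n i (h ∘ suc) (λ j n≤j → h≡0 (suc j) (s≤s n≤j))

  -- The array whose diagonals are the partitions M 0 d and M d 0.
  planar : (ℕ → ℕ → ℕ → ℕ) → ℕ → ℕ → ℕ
  planar M a b = M (a ∸ b) (b ∸ a) (a ⊓ b)

  -- A step down passes to a neighbouring diagonal, so at the edge of the quadrant the claim is one
  -- of the inequalities in `≽`. A common decrement of `a` and `b` amounts to dropping the first
  -- part of every partition.
  planar-row : ∀ M → (∀ i j → M i j ≽ M (suc i) j) → (∀ i j → M i j ≽ M i (suc j)) →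
               ∀ a b → planar M (suc a) b ≤ planar M a b
  planar-row M ≽ʳ ≽ᶜ zero    zero    = proj₁ (≽ʳ 0 0 0)
  planar-row M ≽ʳ ≽ᶜ (suc a) zero    = proj₁ (≽ʳ (suc a) 0 0)
  planar-row M ≽ʳ ≽ᶜ zero    (suc b) rewrite ℕP.0∸n≡0 b = proj₂ (≽ᶜ 0 b 0)
  planar-row M ≽ʳ ≽ᶜ (suc a) (suc b) =
    planar-row (λ i j r → M i j (suc r)) (λ i j r → ≽ʳ i j (suc r)) (λ i j r → ≽ᶜ i j (suc r)) a b

  planar-col : ∀ M → (∀ i j → M i j ≽ M (suc i) j) → (∀ i j → M i j ≽ M i (suc j)) →
               ∀ a b → planar M a (suc b) ≤ planar M a b
  planar-col M ≽ʳ ≽ᶜ zero    zero    = proj₁ (≽ᶜ 0 0 0)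
  planar-col M ≽ʳ ≽ᶜ zero    (suc b) = proj₁ (≽ᶜ 0 (suc b) 0)
  planar-col M ≽ʳ ≽ᶜ (suc a) zero    rewrite ℕP.0∸n≡0 a | ℕP.⊓-zeroʳ a = proj₂ (≽ʳ a 0 0)
  planar-col M ≽ʳ ≽ᶜ (suc a) (suc b) =
    planar-col (λ i j r → M i j (suc r)) (λ i j r → ≽ʳ i j (suc r)) (λ i j r → ≽ᶜ i j (suc r)) a b

  planar-upper : ∀ M r j → planar M r (r + j) ≡ M 0 j r
  planar-upper M r j
    rewrite ℕP.m≤n⇒m∸n≡0 (ℕP.m≤m+n r j) | ℕP.m+n∸m≡n r j | ℕP.m≤n⇒m⊓n≡m (ℕP.m≤m+n r j) = refl

  planar-lower : ∀ M r i → planar M (r + i) r ≡ M i 0 r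
  planar-lower M r i
    rewrite ℕP.m≤n⇒m∸n≡0 (ℕP.m≤m+n r i) | ℕP.m+n∸m≡n r i | ℕP.m≥n⇒m⊓n≡n (ℕP.m≤m+n r i) = refl

  planar-fromBoundary : ∀ π a b → planar (fromBoundary π) a b ≡ π a b
  planar-fromBoundary π a b with ℕP.≤-total a b
  ... | inj₁ a≤b with d , refl ← ℕP.m≤n⇒∃[o]m+o≡n a≤b = planar-upper (fromBoundary π) a d
  ... | inj₂ b≤a with d , refl ← ℕP.m≤n⇒∃[o]m+o≡n b≤a =
    trans (planar-lower (fromBoundary π) b d) (fromBoundary-column π d b)

  antitone : (π : ℕ → ℕ → ℕ) → (∀ a b → π (suc a) b ≤ π a b) → (∀ a b → π a (suc b) ≤ π a b) →
             ∀ {a a′ b b′} → a ≤ a′ → b ≤ b′ → π a′ b′ ≤ π a b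
  antitone π π-row π-col {a} {_} {b} a≤a′ b≤b′
    with d , refl ← ℕP.m≤n⇒∃[o]m+o≡n a≤a′ | e , refl ← ℕP.m≤n⇒∃[o]m+o≡n b≤b′ = ℕP.≤-trans (rows d) (cols e)
    where
    rows : ∀ {c} d → π (a + d) c ≤ π a c
    rows {c} zero    = ℕP.≤-reflexive (cong (λ x → π x c) (ℕP.+-identityʳ a))
    rows {c} (suc d) = ℕP.≤-trans (ℕP.≤-reflexive (cong (λ x → π x c) (ℕP.+-suc a d))) (ℕP.≤-trans (π-row (a + d) c) (rows d))
    cols : ∀ e → π a (b + e) ≤ π a b
    cols zero    = ℕP.≤-reflexive (cong (π a) (ℕP.+-identityʳ b))
    cols (suc e) = ℕP.≤-trans (ℕP.≤-reflexive (cong (π a) (ℕP.+-suc b e))) (ℕP.≤-trans (π-col a (b + e)) (cols e))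

  module _ {n} (y : Array n) (pp : IsPlanePartition y) where

    extend-antitone : ∀ a a′ b b′ → a ≤ a′ → b ≤ b′ → extend y a′ b′ ≤ extend y a b
    extend-antitone a a′ b b′ a≤a′ b≤b′ with ℕP.<-≤-connex a′ n | ℕP.<-≤-connex b′ n
    ... | inj₂ n≤a′ | _ = ℕP.≤-trans (ℕP.≤-reflexive (extend-out-row y a′ b′ n≤a′)) z≤n
    ... | inj₁ _ | inj₂ n≤b′ = ℕP.≤-trans (ℕP.≤-reflexive (extend-out-col y a′ b′ n≤b′)) z≤n
    ... | inj₁ a′<n | inj₁ b′<n =
      subst₂ _≤_ (at-fin a′<n b′<n) (at-fin a<n b<n)
        (pp (fromℕ< a<n) (fromℕ< b<n) (fromℕ< a′<n) (fromℕ< b′<n)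
          (subst₂ _≤_ (sym (toℕ-fromℕ< a<n)) (sym (toℕ-fromℕ< a′<n)) a≤a′)
          (subst₂ _≤_ (sym (toℕ-fromℕ< b<n)) (sym (toℕ-fromℕ< b′<n)) b≤b′))
      where
      a<n = ℕP.≤-<-trans a≤a′ a′<n
      b<n = ℕP.≤-<-trans b≤b′ b′<n
      at-fin : ∀ {a b} (a<n : a < n) (b<n : b < n) → entry y (fromℕ< a<n) (fromℕ< b<n) ≡ extend y a b
      at-fin a<n b<n = trans (sym (extend-toℕ y (fromℕ< a<n) (fromℕ< b<n)))
        (cong₂ (extend y) (toℕ-fromℕ< a<n) (toℕ-fromℕ< b<n))

    growth-extend : Growth n (contents (extend y)) (fromBoundary (extend y))
    growth-extend = growth-fromBoundary n (extend y)
      (λ a b → extend-antitone a (suc a) b b (ℕP.n≤1+n a) ℕP.≤-refl)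
      (λ a b → extend-antitone a a b (suc b) ℕP.≤-refl (ℕP.n≤1+n b))
      (extend-out-row y) (extend-out-col y)

  growth-contents-row : ∀ {n A M} → Growth n A M → ∀ i j → n ≤ i → A i j ≡ 0
  growth-contents-row {M = M} G i j n≤i =
    ℕP.m+n≡0⇒n≡0 (M (suc i) j 0 ⊔ M i (suc j) 0) (trans (sym (first G i j)) (vanishʳ G i j 0 n≤i))

  growth-contents-col : ∀ {n A M} → Growth n A M → ∀ i j → n ≤ j → A i j ≡ 0
  growth-contents-col {M = M} G i j n≤j =
    ℕP.m+n≡0⇒n≡0 (M (suc i) j 0 ⊔ M i (suc j) 0) (trans (sym (first G i j)) (vanishᶜ G i j 0 n≤j))

  module _ {n M A} (G : Growth n A M) where

    planar-out-row : ∀ a b → n ≤ a → planar M a b ≡ 0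
    planar-out-row a b n≤a = vanishʳ G (a ∸ b) (b ∸ a) (a ⊓ b) (ℕP.≤-trans n≤a (ℕP.≤-reflexive
      (sym (trans (cong (_+ (a ∸ b)) (ℕP.⊓-comm a b)) (ℕP.m⊓n+n∸m≡n b a)))))

    planar-out-col : ∀ a b → n ≤ b → planar M a b ≡ 0
    planar-out-col a b n≤b = vanishᶜ G (a ∸ b) (b ∸ a) (a ⊓ b) (ℕP.≤-trans n≤b (ℕP.≤-reflexive
      (sym (ℕP.m⊓n+n∸m≡n a b))))

    isPlanePartition-planar : IsPlanePartition (array n (planar M))
    isPlanePartition-planar i j i′ j′ i≤i′ j≤j′ =
      subst₂ _≤_ (sym (entry-array n (planar M) i′ j′)) (sym (entry-array n (planar M) i j))
        (antitone (planar M) (planar-row M (≽ʳ G) (≽ᶜ G)) (planar-col M (≽ʳ G) (≽ᶜ G)) i≤i′ j≤j′)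

  -- The RSK correspondence

  wordGrowth : ℕ → Word → ℕ → ℕ → ℕ → ℕ
  wordGrowth n w = fromContents n (λ i j → count i j w)

  rsk : ∀ n → Word → Array n
  rsk n w = array n (planar (wordGrowth n w))

  module _ {n} (w : Word) (w<n : Bounded n w) where

    growth-word : Growth n (λ i j → count i j w) (wordGrowth n w)
    growth-word = growth-fromContents n (λ i j → count i j w) (count-out-row w w<n) (count-out-col w w<n)

    extend-rsk : ∀ i j → extend (rsk n w) i j ≡ planar (wordGrowth n w) i j
    extend-rsk = extend-array n (planar (wordGrowth n w)) (planar-out-row growth-word) (planar-out-col growth-word)

    isPlanePartition-rsk : IsPlanePartition (rsk n w)
    isPlanePartition-rsk = isPlanePartition-planar growth-word

    private
      M = wordGrowth n w
      ρ = rsk n w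

    -- The superdiagonal at distance `suc d` is the partition `M 0 (suc d)`, whose size counts the
    -- letters with `b > d`; summed over `d`, each letter contributes `b`.
    wMinus-rsk : wMinus (rsk n w) ≡ tally proj₂ w
    wMinus-rsk = begin
      wMinus ρ
        ≡⟨ sumWhere-∑ _<ᵇ_ ρ ⟩
      ∑ n (λ i → ∑ n (λ j → if i <ᵇ j then extend ρ i j else 0))
        ≡⟨ ∑-cong n (λ i → ∑-if-< n i (extend ρ i) (extend-out-col ρ i)) ⟩
      ∑ n (λ i → ∑ n (λ d → extend ρ i (i + suc d)))
        ≡⟨ ∑-comm n n (λ i d → extend ρ i (i + suc d)) ⟩
      ∑ n (λ d → ∑ n (λ i → extend ρ i (i + suc d)))
        ≡⟨ ∑-cong n (λ d → ∑-cong n (λ i → trans (extend-rsk i (i + suc d)) (planar-upper M i (suc d)))) ⟩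
      ∑ n (λ d → ∑ n (M 0 (suc d)))
        ≡⟨ ∑-cong n (λ d → ∑-growth w w<n growth-word 0 (suc d)) ⟩
      ∑ n (λ d → quadrant 0 (suc d) w)
        ≡⟨ ∑-quadrant-cols w w<n ⟩
      tally proj₂ w ∎

    wPlus-rsk : wPlus (rsk n w) ≡ tally proj₁ w
    wPlus-rsk = begin
      wPlus ρ
        ≡⟨ sumWhere-∑ (λ i j → j <ᵇ i) ρ ⟩
      ∑ n (λ i → ∑ n (λ j → if j <ᵇ i then extend ρ i j else 0))
        ≡⟨ ∑-comm n n (λ i j → if j <ᵇ i then extend ρ i j else 0) ⟩
      ∑ n (λ j → ∑ n (λ i → if j <ᵇ i then extend ρ i j else 0))
        ≡⟨ ∑-cong n (λ j → ∑-if-< n j (λ i → extend ρ i j) (λ i → extend-out-row ρ i j)) ⟩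
      ∑ n (λ j → ∑ n (λ d → extend ρ (j + suc d) j))
        ≡⟨ ∑-comm n n (λ j d → extend ρ (j + suc d) j) ⟩
      ∑ n (λ d → ∑ n (λ j → extend ρ (j + suc d) j))
        ≡⟨ ∑-cong n (λ d → ∑-cong n (λ j → trans (extend-rsk (j + suc d) j) (planar-lower M j (suc d)))) ⟩
      ∑ n (λ d → ∑ n (M (suc d) 0))
        ≡⟨ ∑-cong n (λ d → ∑-growth w w<n growth-word (suc d) 0) ⟩
      ∑ n (λ d → quadrant (suc d) 0 w)
        ≡⟨ ∑-quadrant-rows w w<n ⟩
      tally proj₁ w ∎

    w0-rsk : w0 (rsk n w) ≡ quadrant 0 0 w
    w0-rsk = begin
      w0 ρ
        ≡⟨ sumWhere-∑ _≡ᵇ_ ρ ⟩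
      ∑ n (λ i → ∑ n (λ j → if i ≡ᵇ j then extend ρ i j else 0))
        ≡⟨ ∑-cong n (λ i → ∑-if-≡ n i (extend ρ i) (extend-out-col ρ i)) ⟩
      ∑ n (λ i → extend ρ i i)
        ≡⟨ ∑-cong n (λ i → trans (cong (extend ρ i) (sym (ℕP.+-identityʳ i)))
             (trans (extend-rsk i (i + 0)) (planar-upper M i 0))) ⟩
      ∑ n (M 0 0)
        ≡⟨ ∑-growth w w<n growth-word 0 0 ⟩
      quadrant 0 0 w ∎

    w-rsk : Defs.w (rsk n w) ≡ tally size w
    w-rsk = trans (cong₂ _+_ (cong₂ _+_ wMinus-rsk w0-rsk) wPlus-rsk) (sym (tally-size w))

  rsk-resp-↭ : ∀ {n v w} → Bounded n v → Bounded n w → v ↭ w → rsk n v ≡ rsk n w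
  rsk-resp-↭ {n} {v} {w} v<n w<n v↭w = extend-injective (rsk n v) (rsk n w) λ a b → begin
    extend (rsk n v) a b
      ≡⟨ extend-rsk v v<n a b ⟩
    planar (wordGrowth n v) a b
      ≡⟨ growth-≡-contents (growth-word v v<n) (growth-word w w<n) (λ i j → tally-resp-↭ _ v↭w) (a ∸ b) (b ∸ a) (a ⊓ b) ⟩
    planar (wordGrowth n w) a b
      ≡⟨ extend-rsk w w<n a b ⟨
    extend (rsk n w) a b ∎

  -- The array displays the boundary of the growth diagram, the boundary determines the contents,
  -- and the contents are the multiplicities of the letters.
  rsk-injective : ∀ {n v w} → Bounded n v → Bounded n w → rsk n v ≡ rsk n w → v ↭ w
  rsk-injective {n} {v} {w} v<n w<n eq = count-≡⇒↭ v w (contents-≡-boundary (growth-word v v<n) (growth-word w w<n)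
    (λ j r → trans (sym (planar-upper (wordGrowth n v) r j)) (trans (boundary r (r + j)) (planar-upper (wordGrowth n w) r j)))
    (λ i r → trans (sym (planar-lower (wordGrowth n v) r i)) (trans (boundary (r + i) r) (planar-lower (wordGrowth n w) r i))))
    where
    boundary : ∀ a b → planar (wordGrowth n v) a b ≡ planar (wordGrowth n w) a b
    boundary a b = trans (sym (extend-rsk v v<n a b)) (trans (cong (λ y → extend y a b) eq) (extend-rsk w w<n a b))

  rsk⁻¹ : ∀ {n} → Array n → Word
  rsk⁻¹ {n} y = wordOf n (contents (extend y))

  ∑-≤ : ∀ n (f : ℕ → ℕ) → (∀ r → n ≤ r → f r ≡ 0) → ∀ r → f r ≤ ∑ n f
  ∑-≤ zero    f f≡0 r       = ℕP.≤-reflexive (f≡0 r z≤n)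
  ∑-≤ (suc n) f f≡0 zero    = ℕP.m≤m+n (f 0) (∑ n (f ∘ suc))
  ∑-≤ (suc n) f f≡0 (suc r) =
    ℕP.≤-trans (∑-≤ n (f ∘ suc) (λ r n≤r → f≡0 (suc r) (s≤s n≤r)) r) (ℕP.m≤n+m (∑ n (f ∘ suc)) (f 0))

  module _ {n} (y : Array n) (pp : IsPlanePartition y) where

    private
      counts : ∀ i j → count i j (rsk⁻¹ y) ≡ contents (extend y) i j
      counts = count-wordOf n (contents (extend y))
        (growth-contents-row (growth-extend y pp)) (growth-contents-col (growth-extend y pp))

    bounded-rsk⁻¹ : Bounded n (rsk⁻¹ y)
    bounded-rsk⁻¹ = bounded-wordOf n (contents (extend y))

    -- The diagram grown from the diagonals of `y` and the one grown from the contents read off it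
    -- have equal contents, hence coincide, boundary included.
    rsk-rsk⁻¹ : rsk n (rsk⁻¹ y) ≡ y
    rsk-rsk⁻¹ = extend-injective (rsk n (rsk⁻¹ y)) y λ a b → begin
      extend (rsk n (rsk⁻¹ y)) a b
        ≡⟨ extend-rsk (rsk⁻¹ y) bounded-rsk⁻¹ a b ⟩
      planar (wordGrowth n (rsk⁻¹ y)) a b
        ≡⟨ growth-≡-contents (growth-word (rsk⁻¹ y) bounded-rsk⁻¹) (growth-extend y pp) counts (a ∸ b) (b ∸ a) (a ⊓ b) ⟩
      planar (fromBoundary (extend y)) a b
        ≡⟨ planar-fromBoundary (extend y) a b ⟩
      extend y a b ∎

  -- The enumeration of arrays

  allVecs-suc : ∀ {X : Set} (xs : List X) k → allVecs xs (suc k) ≡ cartesianProductWith _∷_ xs (allVecs xs k)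
  allVecs-suc xs k = go xs
    where
    go : ∀ ys → concatMap (λ x → List.map (x ∷_) (allVecs xs k)) ys ≡ cartesianProductWith _∷_ ys (allVecs xs k)
    go []       = refl
    go (y ∷ ys) = cong (List.map (y ∷_) (allVecs xs k) ++_) (go ys)

  allVecs-unique : ∀ {X : Set} {xs : List X} → Unique xs → ∀ k → Unique (allVecs xs k)
  allVecs-unique u zero    = [] ∷ []
  allVecs-unique {xs = xs} u (suc k) = subst Unique (sym (allVecs-suc xs k))
    (cartesianProductWith⁺ _∷_ ∷-injective u (allVecs-unique u k))

  ∈-allVecs : ∀ {X : Set} {xs : List X} {k} (v : Vec X k) → (∀ i → lookup v i ∈ xs) → v ∈ allVecs xs k
  ∈-allVecs []                _  = here refl
  ∈-allVecs {xs = xs} {suc k} (x ∷ v) x∈ = subst ((x ∷ v) ∈_) (sym (allVecs-suc xs k))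
    (∈-cartesianProductWith⁺ _∷_ (x∈ zero) (∈-allVecs v (x∈ ∘ suc)))

  allArrays-unique : ∀ n → Unique (allArrays n)
  allArrays-unique n = allVecs-unique (allVecs-unique (upTo⁺ (suc n)) n) n

  -- An entry is a part of some `M i j`, so it is at most the size of that partition, a number of
  -- letters, which cannot exceed the total size `n`.
  rsk∈allArrays : ∀ {n} w → tally size w ≡ n → rsk n w ∈ allArrays n
  rsk∈allArrays {n} w refl = ∈-allVecs (rsk n w) λ i → ∈-allVecs (lookup (rsk n w) i) λ j → ∈-upTo⁺ (s≤s (entry≤n i j))
    where
    G = growth-word w (bounded w ℕP.≤-refl)
    entry≤n : ∀ i j → entry (rsk n w) i j ≤ n
    entry≤n i j = ℕP.≤-trans (ℕP.≤-reflexive (entry-array n (planar (wordGrowth n w)) i j))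
      (ℕP.≤-trans (∑-≤ n (wordGrowth n w (a ∸ b) (b ∸ a))
                     (λ r n≤r → Growth.vanishʳ G (a ∸ b) (b ∸ a) r (ℕP.≤-trans n≤r (ℕP.m≤m+n r (a ∸ b)))) (a ⊓ b))
        (ℕP.≤-trans (ℕP.≤-reflexive (∑-growth w (bounded w ℕP.≤-refl) G (a ∸ b) (b ∸ a)))
          (quadrant≤size (a ∸ b) (b ∸ a) w)))
      where
      a = toℕ i
      b = toℕ j

  lookup-unique : ∀ {X : Set} {xs : List X} → Unique xs → ∀ {i j} → List.lookup xs i ≡ List.lookup xs j → i ≡ j
  lookup-unique (x∉ ∷ u) {zero}  {zero}  eq = refl
  lookup-unique (x∉ ∷ u) {zero}  {suc j} eq = contradiction eq (All.lookup x∉ (∈-lookup j))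
  lookup-unique (x∉ ∷ u) {suc i} {zero}  eq = contradiction (sym eq) (All.lookup x∉ (∈-lookup i))
  lookup-unique (x∉ ∷ u) {suc i} {suc j} eq = cong suc (lookup-unique u eq)

-- The sl₂-action and the dimension count

module _ where

  open import Data.Integer using (+_; _+_; _-_; _*_; -_)

  -- Linear dependence over ℤ

  Dependent : ∀ {a b} → (Fin a → Fin b → ℤ) → Set
  Dependent {a} v = ∃ λ (c : Fin a → ℤ) → (∃ λ i → c i ≢ 0ℤ) × (∀ j → sum (λ i → c i * v i j) ≡ 0ℤ)

  -- Gaussian elimination, by cross-multiplication so as to stay in ℤ.
  dependent : ∀ {a b} → b ℕ.< a → (v : Fin a → Fin b → ℤ) → Dependent v
  dependent {suc a} {zero} _ v = (λ _ → 1ℤ) , (zero , λ ()) , λ ()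
  dependent {suc a} {suc b} (s≤s b<a) v with any? (λ i → ¬? (v i zero ℤ.≟ 0ℤ))
  ... | no ¬p with dependent (ℕP.m≤n⇒m≤1+n b<a) (λ i j → v i (suc j))
  ...   | c , c≢0 , cv≡0 = c , c≢0 , λ
          { zero    → trans (sum-cong-≗ λ i → trans (cong (c i *_) (v₀≡0 i)) (ℤP.*-zeroʳ (c i)))
                            (sum-replicate-zero (suc a))
          ; (suc j) → cv≡0 j }
    where
    v₀≡0 : ∀ i → v i zero ≡ 0ℤ
    v₀≡0 i = decidable-stable (v i zero ℤ.≟ 0ℤ) (λ v≢0 → ¬p (i , v≢0))
  dependent {suc a} {suc b} (s≤s b<a) v | yes (i , p≢0)
    with dependent b<a (λ k j → v i zero * v (punchIn i k) (suc j) - v (punchIn i k) zero * v i (suc j))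
  ... | c , (k , ck≢0) , cw≡0 = d , (punchIn i k , dk≢0) , dv≡0
    where
    p = v i zero
    -- Expanding the relation `c` among the reduced rows collects this coefficient on the pivot row
    -- and `p * c k` on each other row.
    s = - sum (λ k → c k * v (punchIn i k) zero)
    d = insertAt (λ k → p * c k) i s

    dk≢0 : d (punchIn i k) ≢ 0ℤ
    dk≢0 eq with ℤP.i*j≡0⇒i≡0∨j≡0 p (trans (sym (insertAt-punchIn (λ k → p * c k) i s k)) eq)
    ... | inj₁ p≡0  = p≢0 p≡0
    ... | inj₂ ck≡0 = ck≢0 ck≡0

    expand : ∀ j → sum (λ l → d l * v l j) ≡ s * v i j + sum (λ k → p * c k * v (punchIn i k) j)
    expand j = begin
      sum (λ l → d l * v l j)
        ≡⟨ sum-remove {i = i} (λ l → d l * v l j) ⟩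
      d i * v i j + sum (λ k → d (punchIn i k) * v (punchIn i k) j)
        ≡⟨ cong₂ _+_ (cong (_* v i j) (insertAt-lookup (λ k → p * c k) i s))
             (sum-cong-≗ λ k → cong (_* v (punchIn i k) j) (insertAt-punchIn (λ k → p * c k) i s k)) ⟩
      s * v i j + sum (λ k → p * c k * v (punchIn i k) j) ∎

    combine : ∀ j → s * v i j + sum (λ k → p * c k * v (punchIn i k) j)
                  ≡ sum (λ k → c k * (p * v (punchIn i k) j - v (punchIn i k) zero * v i j))
    combine j = begin
      s * v i j + sum (λ k → p * c k * v (punchIn i k) j)
        ≡⟨ cong (_+ sum (λ k → p * c k * v (punchIn i k) j)) (lem (sum (λ k → c k * v (punchIn i k) zero)) (v i j)) ⟩
      sum (λ k → c k * v (punchIn i k) zero) * (- v i j) + sum (λ k → p * c k * v (punchIn i k) j)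
        ≡⟨ cong (_+ sum (λ k → p * c k * v (punchIn i k) j)) (*-distribʳ-sum (- v i j) (λ k → c k * v (punchIn i k) zero)) ⟩
      sum (λ k → c k * v (punchIn i k) zero * (- v i j)) + sum (λ k → p * c k * v (punchIn i k) j)
        ≡⟨ ∑-distrib-+ (λ k → c k * v (punchIn i k) zero * (- v i j)) (λ k → p * c k * v (punchIn i k) j) ⟨
      sum (λ k → c k * v (punchIn i k) zero * (- v i j) + p * c k * v (punchIn i k) j)
        ≡⟨ sum-cong-≗ (λ k → lem′ (c k) (v (punchIn i k) zero) (v i j) p (v (punchIn i k) j)) ⟩
      sum (λ k → c k * (p * v (punchIn i k) j - v (punchIn i k) zero * v i j)) ∎
      where
      lem : ∀ x y → - x * y ≡ x * (- y)
      lem = ℤSolver.solve-∀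
      lem′ : ∀ c x y p z → c * x * (- y) + p * c * z ≡ c * (p * z - x * y)
      lem′ = ℤSolver.solve-∀

    dv≡0 : ∀ j → sum (λ l → d l * v l j) ≡ 0ℤ
    dv≡0 zero = trans (expand zero) $ trans (combine zero) $
      trans (sum-cong-≗ λ k → lem (c k) p (v (punchIn i k) zero)) (sum-replicate-zero a)
      where
      lem : ∀ c p x → c * (p * x - x * p) ≡ 0ℤ
      lem = ℤSolver.solve-∀
    dv≡0 (suc j) = trans (expand (suc j)) (trans (combine (suc j)) (cw≡0 j))

  -- Derivations on functions of words

  total : (Letter → ℤ) → Word → ℤ
  total a []      = 0ℤ
  total a (p ∷ w) = a p + total a w

  module _ (κ : Letter → ℤ) (σ : Letter → Letter) where

    -- The derivation acting on functions of one letter by f ↦ κ · (f ∘ σ).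
    der : (Word → ℤ) → Word → ℤ
    der φ []      = 0ℤ
    der φ (p ∷ w) = κ p * φ (σ p ∷ w) + der (λ v → φ (p ∷ v)) w

    der-cong : ∀ {φ ψ} → (∀ v → φ v ≡ ψ v) → ∀ w → der φ w ≡ der ψ w
    der-cong φ≗ψ []      = refl
    der-cong φ≗ψ (p ∷ w) =
      cong₂ _+_ (cong (κ p *_) (φ≗ψ (σ p ∷ w))) (der-cong (λ v → φ≗ψ (p ∷ v)) w)

    der-+ : ∀ φ ψ w → der (λ v → φ v + ψ v) w ≡ der φ w + der ψ w
    der-+ φ ψ []      = refl
    der-+ φ ψ (p ∷ w) = begin
      κ p * (φ q + ψ q) + der (λ v → φ (p ∷ v) + ψ (p ∷ v)) w
        ≡⟨ cong (λ z → κ p * (φ q + ψ q) + z) (der-+ (λ v → φ (p ∷ v)) (λ v → ψ (p ∷ v)) w) ⟩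
      κ p * (φ q + ψ q) + (x + y)
        ≡⟨ lem (κ p) (φ q) (ψ q) x y ⟩
      κ p * φ q + x + (κ p * ψ q + y) ∎
      where
      q = σ p ∷ w
      x = der (λ v → φ (p ∷ v)) w
      y = der (λ v → ψ (p ∷ v)) w
      lem : ∀ k f g x y → k * (f + g) + (x + y) ≡ k * f + x + (k * g + y)
      lem = ℤSolver.solve-∀

    der-* : ∀ c φ w → der (λ v → c * φ v) w ≡ c * der φ w
    der-* c φ []      = sym (ℤP.*-zeroʳ c)
    der-* c φ (p ∷ w) = begin
      κ p * (c * φ (σ p ∷ w)) + der (λ v → c * φ (p ∷ v)) w
        ≡⟨ cong (λ z → κ p * (c * φ (σ p ∷ w)) + z) (der-* c (λ v → φ (p ∷ v)) w) ⟩
      κ p * (c * φ (σ p ∷ w)) + c * der (λ v → φ (p ∷ v)) w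
        ≡⟨ lem (κ p) c (φ (σ p ∷ w)) (der (λ v → φ (p ∷ v)) w) ⟩
      c * (κ p * φ (σ p ∷ w) + der (λ v → φ (p ∷ v)) w) ∎
      where
      lem : ∀ k c f x → k * (c * f) + c * x ≡ c * (k * f + x)
      lem = ℤSolver.solve-∀

    der-zero : ∀ {φ} → (∀ v → φ v ≡ 0ℤ) → ∀ w → der φ w ≡ 0ℤ
    der-zero φ≗0 []      = refl
    der-zero φ≗0 (p ∷ w) =
      cong₂ _+_ (trans (cong (κ p *_) (φ≗0 (σ p ∷ w))) (ℤP.*-zeroʳ (κ p))) (der-zero (λ v → φ≗0 (p ∷ v)) w)

    -- Each summand replaces one letter, changing the total by `c`. The hypothesis carries the
    -- factor `κ p` because `σ` is to be built with `pred`, whose truncated values occur only where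
    -- `κ` vanishes.
    der-total : ∀ a c → (∀ p → κ p * a (σ p) ≡ κ p * (a p + c)) →
                ∀ φ w → der (λ v → total a v * φ v) w ≡ total a w * der φ w + c * der φ w
    der-total a c shift φ []      = sym (cong (λ z → 0ℤ + z) (ℤP.*-zeroʳ c))
    der-total a c shift φ (p ∷ w) = begin
      κ p * ((a (σ p) + t) * f) + der (λ v → (a p + total a v) * φ (p ∷ v)) w
        ≡⟨ cong₂ _+_ first second ⟩
      κ p * (a p + c) * f + κ p * (t * f) + (a p * x + (t * x + c * x))
        ≡⟨ lem₂ (κ p) (a p) c f t x ⟩
      (a p + t) * (κ p * f + x) + c * (κ p * f + x) ∎
      where
      f = φ (σ p ∷ w)
      t = total a w
      x = der (λ v → φ (p ∷ v)) w
      lem₁ : ∀ k a t f → k * ((a + t) * f) ≡ k * a * f + k * (t * f)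
      lem₁ = ℤSolver.solve-∀
      lem₂ : ∀ k a c f t x →
             k * (a + c) * f + k * (t * f) + (a * x + (t * x + c * x))
           ≡ (a + t) * (k * f + x) + c * (k * f + x)
      lem₂ = ℤSolver.solve-∀
      first : κ p * ((a (σ p) + t) * f) ≡ κ p * (a p + c) * f + κ p * (t * f)
      first = trans (lem₁ (κ p) (a (σ p)) t f) (cong (λ z → z * f + κ p * (t * f)) (shift p))
      second : der (λ v → (a p + total a v) * φ (p ∷ v)) w ≡ a p * x + (t * x + c * x)
      second = begin
        der (λ v → (a p + total a v) * φ (p ∷ v)) w
          ≡⟨ der-cong (λ v → ℤP.*-distribʳ-+ (φ (p ∷ v)) (a p) (total a v)) w ⟩
        der (λ v → a p * φ (p ∷ v) + total a v * φ (p ∷ v)) w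
          ≡⟨ der-+ (λ v → a p * φ (p ∷ v)) (λ v → total a v * φ (p ∷ v)) w ⟩
        der (λ v → a p * φ (p ∷ v)) w + der (λ v → total a v * φ (p ∷ v)) w
          ≡⟨ cong₂ _+_ (der-* (a p) (λ v → φ (p ∷ v)) w) (der-total a c shift (λ v → φ (p ∷ v)) w) ⟩
        a p * x + (t * x + c * x) ∎

    -- All positions are treated alike: at a swap the two leading summands trade places, and in the
    -- remaining ones `φ` itself does not see the order of the two heads.
    der-resp-↭ : ∀ {φ} → (∀ {v w} → v ↭ w → φ v ≡ φ w) →
                 ∀ {v w} → v ↭ w → der φ v ≡ der φ w
    der-resp-↭ φ-resp _↭_.refl = refl
    der-resp-↭ φ-resp (prep p v↭w) =
      cong₂ _+_ (cong (κ p *_) (φ-resp (prep (σ p) v↭w)))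
                (der-resp-↭ (φ-resp ∘ prep p) v↭w)
    der-resp-↭ {φ} φ-resp (swap {xs = v} {ys = w} p q v↭w) = begin
      κ p * φ (σ p ∷ q ∷ v) + (κ q * φ (p ∷ σ q ∷ v) + der (λ u → φ (p ∷ q ∷ u)) v)
        ≡⟨ cong₂ (λ x y → κ p * x + (κ q * y + der (λ u → φ (p ∷ q ∷ u)) v))
             (φ-resp (swap (σ p) q v↭w)) (φ-resp (swap p (σ q) v↭w)) ⟩
      κ p * φ (q ∷ σ p ∷ w) + (κ q * φ (σ q ∷ p ∷ w) + der (λ u → φ (p ∷ q ∷ u)) v)
        ≡⟨ lem (κ p * φ (q ∷ σ p ∷ w)) (κ q * φ (σ q ∷ p ∷ w)) (der (λ u → φ (p ∷ q ∷ u)) v) ⟩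
      κ q * φ (σ q ∷ p ∷ w) + (κ p * φ (q ∷ σ p ∷ w) + der (λ u → φ (p ∷ q ∷ u)) v)
        ≡⟨ cong (λ z → κ q * φ (σ q ∷ p ∷ w) + (κ p * φ (q ∷ σ p ∷ w) + z))
             (trans (der-resp-↭ (φ-resp ∘ prep p ∘ prep q) v↭w)
                      (der-cong (λ u → φ-resp (swap p q ↭-refl)) w)) ⟩
      κ q * φ (σ q ∷ p ∷ w) + (κ p * φ (q ∷ σ p ∷ w) + der (λ u → φ (q ∷ p ∷ u)) w) ∎
      where
      lem : ∀ x y z → x + (y + z) ≡ y + (x + z)
      lem = ℤSolver.solve-∀
    der-resp-↭ φ-resp (_↭_.trans u↭v v↭w) = trans (der-resp-↭ φ-resp u↭v) (der-resp-↭ φ-resp v↭w)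

  -- Summands acting on two different letters occur in both orders and cancel. What survives acts
  -- twice on one letter, so the commutator is fixed by its one-letter action, here multiplication
  -- by `h`.
  der-commutator : ∀ κ₁ σ₁ κ₂ σ₂ h →
    (∀ p (f : Letter → ℤ) → κ₁ p * (κ₂ (σ₁ p) * f (σ₂ (σ₁ p)))
                          ≡ κ₂ p * (κ₁ (σ₂ p) * f (σ₁ (σ₂ p))) + h p * f p) →
    ∀ φ w → der κ₁ σ₁ (der κ₂ σ₂ φ) w ≡ der κ₂ σ₂ (der κ₁ σ₁ φ) w + total h w * φ w
  der-commutator κ₁ σ₁ κ₂ σ₂ h letter φ []      = refl
  der-commutator κ₁ σ₁ κ₂ σ₂ h letter φ (p ∷ w) = begin
    D₁ (D₂ φ) (p ∷ w)
      ≡⟨ expand κ₁ σ₁ κ₂ σ₂ ⟩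
    κ₁ p * (κ₂ (σ₁ p) * φ (σ₂ (σ₁ p) ∷ w)) + (κ₁ p * x₁ + (κ₂ p * x₂ + D₁ (D₂ (λ v → φ (p ∷ v))) w))
      ≡⟨ cong₂ (λ y z → y + (κ₁ p * x₁ + (κ₂ p * x₂ + z)))
           (letter p (λ q → φ (q ∷ w))) (der-commutator κ₁ σ₁ κ₂ σ₂ h letter (λ v → φ (p ∷ v)) w) ⟩
    κ₂ p * (κ₁ (σ₂ p) * φ (σ₁ (σ₂ p) ∷ w)) + h p * f
      + (κ₁ p * x₁ + (κ₂ p * x₂ + (D₂ (D₁ (λ v → φ (p ∷ v))) w + total h w * f)))
      ≡⟨ lem (κ₂ p * (κ₁ (σ₂ p) * φ (σ₁ (σ₂ p) ∷ w))) (h p) f (κ₁ p * x₁) (κ₂ p * x₂)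
             (D₂ (D₁ (λ v → φ (p ∷ v))) w) (total h w) ⟩
    κ₂ p * (κ₁ (σ₂ p) * φ (σ₁ (σ₂ p) ∷ w)) + (κ₂ p * x₂ + (κ₁ p * x₁ + D₂ (D₁ (λ v → φ (p ∷ v))) w))
      + (h p + total h w) * f
      ≡⟨ cong (_+ (h p + total h w) * f) (sym (expand κ₂ σ₂ κ₁ σ₁)) ⟩
    D₂ (D₁ φ) (p ∷ w) + (h p + total h w) * f ∎
    where
    D₁ = der κ₁ σ₁
    D₂ = der κ₂ σ₂
    f  = φ (p ∷ w)
    x₁ = D₂ (λ v → φ (σ₁ p ∷ v)) w
    x₂ = D₁ (λ v → φ (σ₂ p ∷ v)) w
    lem : ∀ y h f a b c t →
          y + h * f + (a + (b + (c + t * f))) ≡ y + (b + (a + c)) + (h + t) * f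
    lem = ℤSolver.solve-∀
    lem′ : ∀ a b c d e → a * (b + c) + (d + e) ≡ a * b + (a * c + (d + e))
    lem′ = ℤSolver.solve-∀
    expand : ∀ κ₁ σ₁ κ₂ σ₂ → der κ₁ σ₁ (der κ₂ σ₂ φ) (p ∷ w)
           ≡ κ₁ p * (κ₂ (σ₁ p) * φ (σ₂ (σ₁ p) ∷ w))
             + (κ₁ p * der κ₂ σ₂ (λ v → φ (σ₁ p ∷ v)) w
                + (κ₂ p * der κ₁ σ₁ (λ v → φ (σ₂ p ∷ v)) w
                   + der κ₁ σ₁ (der κ₂ σ₂ (λ v → φ (p ∷ v))) w))
    expand κ₁ σ₁ κ₂ σ₂ = begin
      κ₁ p * (y + z) + der κ₁ σ₁ (λ v → κ₂ p * φ (σ₂ p ∷ v) + der κ₂ σ₂ (λ u → φ (p ∷ u)) v) w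
        ≡⟨ cong (λ t → κ₁ p * (y + z) + t) (trans
             (der-+ κ₁ σ₁ (λ v → κ₂ p * φ (σ₂ p ∷ v)) (der κ₂ σ₂ (λ u → φ (p ∷ u))) w)
             (cong (_+ t) (der-* κ₁ σ₁ (κ₂ p) (λ v → φ (σ₂ p ∷ v)) w))) ⟩
      κ₁ p * (y + z) + (κ₂ p * der κ₁ σ₁ (λ v → φ (σ₂ p ∷ v)) w + t)
        ≡⟨ lem′ (κ₁ p) y z (κ₂ p * der κ₁ σ₁ (λ v → φ (σ₂ p ∷ v)) w) t ⟩
      _ ∎
      where
      y = κ₂ (σ₁ p) * φ (σ₂ (σ₁ p) ∷ w)
      z = der κ₂ σ₂ (λ v → φ (σ₁ p ∷ v)) w
      t = der κ₁ σ₁ (der κ₂ σ₂ (λ v → φ (p ∷ v))) w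

  -- The sl₂-operators, weights and degrees

  deg wt : Letter → ℤ
  deg p       = + size p
  wt  (a , b) = + b - + a

  -- The letters (a , b) with a + b = k span Vₖ.  As φ is a function on words, lower φ is supported
  -- in weight m when φ is supported in weight m + 2.
  lower raise : (Word → ℤ) → Word → ℤ
  lower = der (λ (a , b) → + a) (λ (a , b) → pred a , suc b)
  raise = der (λ (a , b) → + b) (λ (a , b) → suc a , pred b)

  lower-deg : ∀ φ w → lower (λ v → total deg v * φ v) w ≡ total deg w * lower φ w + 0ℤ * lower φ w
  lower-deg = der-total _ _ deg 0ℤ λ
    { (zero , b) → refl
    ; (suc a , b) → cong (+ suc a *_) (trans (cong (+_ ∘ suc) (ℕP.+-suc a b)) (sym (ℤP.+-identityʳ (+ suc (suc a ℕ.+ b))))) }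

  raise-deg : ∀ φ w → raise (λ v → total deg v * φ v) w ≡ total deg w * raise φ w + 0ℤ * raise φ w
  raise-deg = der-total _ _ deg 0ℤ λ
    { (a , zero) → refl
    ; (a , suc b) → cong (+ suc b *_) (trans (cong (+_ ∘ suc) (sym (ℕP.+-suc a b))) (sym (ℤP.+-identityʳ (+ suc (a ℕ.+ suc b))))) }

  -- `lower` evaluates `φ` at words with one letter moved up by 2 in weight, so the shift is `+ 2`
  -- although the weight of the support falls by 2.
  lower-wt : ∀ φ w → lower (λ v → total wt v * φ v) w ≡ total wt w * lower φ w + + 2 * lower φ w
  lower-wt = der-total _ _ wt (+ 2) λ
    { (zero , b) → refl
    ; (suc a , b) → cong (+ suc a *_) (lem (+ a) (+ b)) }
    where
    lem : ∀ a b → 1ℤ + b - a ≡ b - (1ℤ + a) + + 2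
    lem = ℤSolver.solve-∀

  raise-wt : ∀ φ w → raise (λ v → total wt v * φ v) w ≡ total wt w * raise φ w + (- (+ 2)) * raise φ w
  raise-wt = der-total _ _ wt (- (+ 2)) λ
    { (a , zero) → refl
    ; (a , suc b) → cong (+ suc b *_) (lem (+ a) (+ b)) }
    where
    lem : ∀ a b → b - (1ℤ + a) ≡ 1ℤ + b - a + (- (+ 2))
    lem = ℤSolver.solve-∀

  total-neg : ∀ a w → total (λ p → - a p) w ≡ - total a w
  total-neg a []      = refl
  total-neg a (p ∷ w) = trans (cong (λ z → - a p + z) (total-neg a w)) (sym (ℤP.neg-distrib-+ (a p) (total a w)))

  -- The defining relation of sl₂; on one letter it reads `a(b+1) - b(a+1) = a - b`, the negative of
  -- the weight.
  lower-raise : ∀ φ w → lower (raise φ) w ≡ raise (lower φ) w + (- total wt w) * φ w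
  lower-raise φ w = trans
    (der-commutator _ _ _ _ (λ p → - wt p) letter φ w)
    (cong (λ t → raise (lower φ) w + t * φ w) (total-neg wt w))
    where
    lem : ∀ a b f → (1ℤ + a) * ((1ℤ + (1ℤ + b)) * f)
                  ≡ (1ℤ + b) * ((1ℤ + (1ℤ + a)) * f) + (- (1ℤ + b - (1ℤ + a))) * f
    lem = ℤSolver.solve-∀
    -- With `a = 0` or `b = 0` one of the two composites has coefficient 0, so the truncated `pred`
    -- does no harm.
    lem₁ : ∀ a f → (1ℤ + a) * (1ℤ * f) ≡ 0ℤ + (- (0ℤ - (1ℤ + a))) * f
    lem₁ = ℤSolver.solve-∀
    lem₂ : ∀ b f → 0ℤ ≡ (1ℤ + b) * (1ℤ * f) + (- (1ℤ + b - 0ℤ)) * f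
    lem₂ = ℤSolver.solve-∀
    letter : ∀ p (f : Letter → ℤ) → _
    letter (zero  , zero)  f = refl
    letter (zero  , suc b) f = lem₂ (+ b) (f (zero , suc b))
    letter (suc a , zero)  f = lem₁ (+ a) (f (suc a , zero))
    letter (suc a , suc b) f = lem (+ a) (+ b) (f (suc a , suc b))

  -- Multiplication by `total a` is diagonal on functions, so this says that `φ` is supported where
  -- `total a` equals `x`. As an equation it passes through derivations by commutation.
  Eigen : (Letter → ℤ) → ℤ → (Word → ℤ) → Set
  Eigen a x φ = ∀ w → total a w * φ w ≡ x * φ w

  eigen-zero : ∀ a x {φ} → Eigen a x φ → ∀ w → total a w ≢ x → φ w ≡ 0ℤ
  eigen-zero a x {φ} eig w ≢x with φ w ℤ.≟ 0ℤ
  ... | yes φ≡0 = φ≡0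
  ... | no  φ≢0 = contradiction (ℤP.*-cancelʳ-≡ (total a w) x (φ w) {{ℤ.≢-nonZero φ≢0}} (eig w)) ≢x

  der-eigen : ∀ κ σ a x y c → y + c ≡ x →
    (∀ φ w → der κ σ (λ v → total a v * φ v) w ≡ total a w * der κ σ φ w + c * der κ σ φ w) →
    ∀ {φ} → Eigen a x φ → Eigen a y (der κ σ φ)
  der-eigen κ σ a x y c y+c≡x shift {φ} eig w = ∙-cancelʳ (c * D) (total a w * D) (y * D) (begin
    total a w * D + c * D              ≡⟨ shift φ w ⟨
    der κ σ (λ v → total a v * φ v) w  ≡⟨ der-cong κ σ eig w ⟩
    der κ σ (λ v → x * φ v) w          ≡⟨ der-* κ σ x φ w ⟩
    x * D                              ≡⟨ cong (_* D) y+c≡x ⟨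
    (y + c) * D                        ≡⟨ ℤP.*-distribʳ-+ D y c ⟩
    y * D + c * D                      ∎)
    where
    D = der κ σ φ w

  -- In degree `n` no weight exceeds `n`: this is what stops repeated raising.
  wt≤deg : ∀ w → total wt w ℤ.≤ total deg w
  wt≤deg []            = ℤP.≤-refl
  wt≤deg ((a , b) ∷ w) = ℤP.+-mono-≤
    (ℤP.≤-trans (ℤP.i-j≤i (+ b) (+ a)) (ℤ.+≤+ (ℕP.m≤n⇒m≤1+n (ℕP.m≤n+m b a)))) (wt≤deg w)

  -- Injectivity of `lower` in positive weight

  module _ {h n : ℕ} {φ : Word → ℤ} (wt-φ : Eigen wt (+ suc h) φ) (deg-φ : Eigen deg (+ n) φ)
           (lower-φ : ∀ w → lower φ w ≡ 0ℤ) where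

    private
      raised : ℕ → Word → ℤ
      raised zero    = φ
      raised (suc k) = raise (raised k)

      wt-raised : ∀ k → Eigen wt (+ suc h + + 2 * + k) (raised k)
      wt-raised zero    = subst (λ x → Eigen wt x φ) (sym (ℤP.+-identityʳ (+ suc h))) wt-φ
      wt-raised (suc k) = der-eigen _ _ wt _ (+ suc h + + 2 * + suc k) (- (+ 2)) (lem (+ suc h) (+ k)) raise-wt (wt-raised k)
        where
        lem : ∀ h k → h + + 2 * (1ℤ + k) + (- (+ 2)) ≡ h + + 2 * k
        lem = ℤSolver.solve-∀

      deg-raised : ∀ k → Eigen deg (+ n) (raised k)
      deg-raised zero    = deg-φ
      deg-raised (suc k) = der-eigen _ _ deg _ (+ n) 0ℤ (ℤP.+-identityʳ (+ n)) raise-deg (deg-raised k)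

      -- Moving `lower` past the successive factors `raise` produces minus the weights `suc h + 2i`
      -- for `i ≤ k`, whose sum is `(k+1)(suc h + k)`; the last term, `lower φ`, is zero.
      lower-raised : ∀ k w → lower (raised (suc k)) w ≡ (- (+ suc k * + (suc h ℕ.+ k))) * raised k w
      lower-raised k w = begin
        lower (raise (raised k)) w
          ≡⟨ lower-raise (raised k) w ⟩
        raise (lower (raised k)) w + (- total wt w) * raised k w
          ≡⟨ cong₂ _+_ (step k w) (trans (sym (ℤP.neg-distribˡ-* (total wt w) (raised k w)))
                                    (trans (cong -_ (wt-raised k w)) (ℤP.neg-distribˡ-* (+ suc h + + 2 * + k) (raised k w)))) ⟩
        (- (+ k * (+ suc h + + k - 1ℤ))) * raised k w + (- (+ suc h + + 2 * + k)) * raised k w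
          ≡⟨ lem (+ suc h) (+ k) (raised k w) ⟩
        (- (+ suc k * + (suc h ℕ.+ k))) * raised k w ∎
        where
        lem : ∀ h k f → (- (k * (h + k - 1ℤ))) * f + (- (h + + 2 * k)) * f ≡ (- ((1ℤ + k) * (h + k))) * f
        lem = ℤSolver.solve-∀
        lem′ : ∀ h k → h + k ≡ h + (1ℤ + k) - 1ℤ
        lem′ = ℤSolver.solve-∀
        -- The coefficient for `k - 1`, written with subtraction in ℤ so that `k = 0` fits: there
        -- the factor `+ k` vanishes, as `lower φ` does.
        step : ∀ k w → raise (lower (raised k)) w ≡ (- (+ k * (+ suc h + + k - 1ℤ))) * raised k w
        step zero    w = der-zero _ _ lower-φ w
        step (suc k) w = begin
          raise (lower (raised (suc k))) w
            ≡⟨ der-cong _ _ (lower-raised k) w ⟩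
          raise (λ v → (- (+ suc k * + (suc h ℕ.+ k))) * raised k v) w
            ≡⟨ der-* _ _ (- (+ suc k * + (suc h ℕ.+ k))) (raised k) w ⟩
          (- (+ suc k * + (suc h ℕ.+ k))) * raised (suc k) w
            ≡⟨ cong (λ z → (- (+ suc k * z)) * raised (suc k) w) (lem′ (+ suc h) (+ k)) ⟩
          (- (+ suc k * (+ suc h + + suc k - 1ℤ))) * raised (suc k) w ∎

      -- The degree is still `n`, while the weight `suc h + 2n` already exceeds it.
      raised-top : ∀ w → raised n w ≡ 0ℤ
      raised-top w with total deg w ℤ.≟ + n
      ... | no  ≢n = eigen-zero deg (+ n) (deg-raised n) w ≢n
      ... | yes ≡n = eigen-zero wt (+ suc h + + 2 * + n) (wt-raised n) w λ wt≡ → ℕP.<⇒≱ {n} {suc h ℕ.+ 2 ℕ.* n}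
            (s≤s (ℕP.≤-trans (ℕP.m≤m+n n (n ℕ.+ 0)) (ℕP.m≤n+m (2 ℕ.* n) h)))
            (ℤP.drop‿+≤+ (subst₂ ℤ._≤_ (trans wt≡ (cong (λ z → + suc h + z) (sym (ℤP.pos-* 2 n)))) ≡n (wt≤deg w)))

      descend : ∀ k → (∀ w → raised (suc k) w ≡ 0ℤ) → ∀ w → raised k w ≡ 0ℤ
      descend k raised≡0 w with ℤP.i*j≡0⇒i≡0∨j≡0 (- (+ suc k * + (suc h ℕ.+ k)))
                                 (trans (sym (lower-raised k w)) (der-zero _ _ raised≡0 w))
      ... | inj₂ eq = eq
      -- Positivity of the weight enters here: `suc k` and `suc h + k` are positive, so the
      -- coefficient is a negative integer.
      ... | inj₁ ()

      raised-zero : ∀ k → (∀ w → raised k w ≡ 0ℤ) → ∀ w → φ w ≡ 0ℤ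
      raised-zero zero    eq = eq
      raised-zero (suc k) eq = raised-zero k (descend k eq)

    lower-injective : ∀ w → φ w ≡ 0ℤ
    lower-injective = raised-zero n raised-top

  -- The basis indexed by plane partitions

  total-deg : ∀ w → total deg w ≡ + tally size w
  total-deg []            = refl
  total-deg ((a , b) ∷ w) = cong (λ z → + suc (a ℕ.+ b) + z) (total-deg w)

  total-wt : ∀ w → total wt w ≡ + tally proj₂ w - + tally proj₁ w
  total-wt []            = refl
  total-wt ((a , b) ∷ w) = trans (cong (λ z → + b - + a + z) (total-wt w))
    (lem (+ a) (+ b) (+ tally proj₁ w) (+ tally proj₂ w))
    where
    lem : ∀ a b x y → b - a + (y - x) ≡ b + y - (a + x)
    lem = ℤSolver.solve-∀

  module _ {n} (w : Word) (w<n : Bounded n w) where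

    wt-rsk : + wMinus (rsk n w) - + wPlus (rsk n w) ≡ total wt w
    wt-rsk = trans (cong₂ (λ x y → + x - + y) (wMinus-rsk w w<n) (wPlus-rsk w w<n)) (sym (total-wt w))

    counted-rsk : ∀ {ℓ} → tally size w ≡ n → total wt w ≡ ℓ → Counted ℓ n (rsk n w)
    counted-rsk size≡ wt≡ = isPlanePartition-rsk w w<n , trans (w-rsk w w<n) size≡ , trans wt-rsk wt≡

  sum-single : ∀ {a} (t : Fin a → ℤ) i z → t i ≡ z → (∀ k → k ≢ i → t k ≡ 0ℤ) → sum t ≡ z
  sum-single {suc a} t i z ti≡z t≡0 = begin
    sum t                     ≡⟨ sum-remove {i = i} t ⟩
    t i + sum (t ∘ punchIn i) ≡⟨ cong₂ _+_ ti≡z (trans (sum-cong-≗ λ k → t≡0 (punchIn i k) (punchInᵢ≢i i k))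
                                                       (sum-replicate-zero a)) ⟩
    z + 0ℤ                    ≡⟨ ℤP.+-identityʳ z ⟩
    z                         ∎

  der-sum : ∀ κ σ {a} (c : Fin a → ℤ) (φ : Fin a → Word → ℤ) w →
            der κ σ (λ v → sum (λ i → c i * φ i v)) w ≡ sum (λ i → c i * der κ σ (φ i) w)
  der-sum κ σ {zero}  c φ w = der-zero κ σ (λ _ → refl) w
  der-sum κ σ {suc a} c φ w = trans
    (der-+ κ σ (λ v → c zero * φ zero v) (λ v → sum (λ i → c (suc i) * φ (suc i) v)) w)
    (cong₂ _+_ (der-* κ σ (c zero) (φ zero) w) (der-sum κ σ (c ∘ suc) (φ ∘ suc) w))

  module _ {n} (y : Array n) where

    -- The size condition fixes the degree and makes the word bounded by `n`, as the results on
    -- `rsk` require.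
    Represents : Word → Set
    Represents w = tally size w ≡ n × rsk n w ≡ y

    represents? : ∀ w → Dec (Represents w)
    represents? w = (tally size w ℕ.≟ n) ×-dec ≡-dec (≡-dec ℕ._≟_) (rsk n w) y

    -- For a plane partition `y` of weight `n` this is the indicator of a single permutation class
    -- of words, a standard basis vector of the invariant functions of degree `n`.
    indicator : Word → ℤ
    indicator w = if does (represents? w) then 1ℤ else 0ℤ

    indicator-1 : ∀ w → Represents w → indicator w ≡ 1ℤ
    indicator-1 w r = cong (λ b → if b then 1ℤ else 0ℤ) (dec-true (represents? w) r)

    indicator-0 : ∀ w → ¬ Represents w → indicator w ≡ 0ℤ
    indicator-0 w ¬r = cong (λ b → if b then 1ℤ else 0ℤ) (dec-false (represents? w) ¬r)

    represents-resp-↭ : ∀ {v w} → v ↭ w → Represents v → Represents w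
    represents-resp-↭ {v} {w} v↭w (size≡ , rsk≡) =
      size≡′ , trans (sym (rsk-resp-↭ (bounded v (ℕP.≤-reflexive size≡)) (bounded w (ℕP.≤-reflexive size≡′)) v↭w)) rsk≡
      where size≡′ = trans (sym (tally-resp-↭ size v↭w)) size≡

    indicator-resp-↭ : ∀ {v w} → v ↭ w → indicator v ≡ indicator w
    indicator-resp-↭ {v} {w} v↭w = go (represents? v)
      where
      go : Dec (Represents v) → indicator v ≡ indicator w
      go (yes r) = trans (indicator-1 v r) (sym (indicator-1 w (represents-resp-↭ v↭w r)))
      go (no ¬r) = trans (indicator-0 v ¬r) (sym (indicator-0 w (λ r → ¬r (represents-resp-↭ (↭-sym v↭w) r))))

  represents-rsk⁻¹ : ∀ {n ℓ} (y : Array n) → Counted ℓ n y → Represents y (rsk⁻¹ y)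
  represents-rsk⁻¹ y (pp , w≡n , _) =
    trans (sym (w-rsk (rsk⁻¹ y) (bounded-rsk⁻¹ y pp))) (trans (cong w (rsk-rsk⁻¹ y pp)) w≡n) , rsk-rsk⁻¹ y pp

  eigen-intro : ∀ a x {φ} → (∀ w → total a w ≢ x → φ w ≡ 0ℤ) → Eigen a x φ
  eigen-intro a x {φ} φ≡0 w with total a w ℤ.≟ x
  ... | yes eq = cong (_* φ w) eq
  ... | no ≢x  = trans (cong (total a w *_) (φ≡0 w ≢x)) (trans (ℤP.*-zeroʳ (total a w))
                   (sym (trans (cong (x *_) (φ≡0 w ≢x)) (ℤP.*-zeroʳ x))))

  -- Comparison of dimensions

  module _ (m n : ℕ) where

    private
      X Y : List (Array n)
      X = filter (counted? (+ (m ℕ.+ 2)) n) (allArrays n)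
      Y = filter (counted? (+ m) n) (allArrays n)

      x : Fin (length X) → Array n
      x = List.lookup X
      y : Fin (length Y) → Array n
      y = List.lookup Y

      counted-x : ∀ i → Counted (+ (m ℕ.+ 2)) n (x i)
      counted-x i = proj₂ (∈-filter⁻ (counted? (+ (m ℕ.+ 2)) n) {xs = allArrays n} (∈-lookup i))

      counted-y : ∀ j → Counted (+ m) n (y j)
      counted-y j = proj₂ (∈-filter⁻ (counted? (+ m) n) {xs = allArrays n} (∈-lookup j))

      x-injective : ∀ {i j} → x i ≡ x j → i ≡ j
      x-injective = lookup-unique (filter⁺ (counted? (+ (m ℕ.+ 2)) n) (allArrays-unique n))

      -- The matrix of `lower` from weight `m + 2` to weight `m`; an invariant function is known
      -- from one representative word per class.
      v : Fin (length X) → Fin (length Y) → ℤ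
      v i j = lower (indicator (x i)) (rsk⁻¹ (y j))

      module _ (c : Fin (length X) → ℤ) (cv≡0 : ∀ j → sum (λ i → c i * v i j) ≡ 0ℤ) where

        φ : Word → ℤ
        φ w = sum (λ i → c i * indicator (x i) w)

        φ-zero : ∀ w → (∀ i → ¬ Represents (x i) w) → φ w ≡ 0ℤ
        φ-zero w ¬r = trans (sum-cong-≗ λ i → trans (cong (c i *_) (indicator-0 (x i) w (¬r i))) (ℤP.*-zeroʳ (c i)))
          (sum-replicate-zero (length X))

        φ-resp-↭ : ∀ {u w} → u ↭ w → φ u ≡ φ w
        φ-resp-↭ u↭w = sum-cong-≗ λ i → cong (c i *_) (indicator-resp-↭ (x i) u↭w)

        deg-φ : Eigen deg (+ n) φ
        deg-φ = eigen-intro deg (+ n) λ w ≢n → φ-zero w λ i (size≡ , _) → ≢n (trans (total-deg w) (cong +_ size≡))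

        wt-φ : Eigen wt (+ (m ℕ.+ 2)) φ
        wt-φ = eigen-intro wt (+ (m ℕ.+ 2)) λ w ≢m+2 → φ-zero w λ i (size≡ , rsk≡) →
          ≢m+2 (trans (sym (wt-rsk w (bounded w (ℕP.≤-reflexive size≡))))
                 (trans (cong (λ z → + wMinus z - + wPlus z) rsk≡) (proj₂ (proj₂ (counted-x i)))))

        -- By invariance `w` may be replaced by the representative of its class, where the value is
        -- a column of the relation `c`.
        lower-φ-weight-m : ∀ w → tally size w ≡ n → total wt w ≡ + m → lower φ w ≡ 0ℤ
        lower-φ-weight-m w size≡ wt≡ = begin
          lower φ w                ≡⟨ der-resp-↭ _ _ φ-resp-↭ w↭ ⟩
          lower φ (rsk⁻¹ (y j))    ≡⟨ der-sum _ _ c (λ i → indicator (x i)) (rsk⁻¹ (y j)) ⟩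
          sum (λ i → c i * v i j)  ≡⟨ cv≡0 j ⟩
          0ℤ                       ∎
          where
          w<n : Bounded n w
          w<n = bounded w (ℕP.≤-reflexive size≡)
          w∈Y : rsk n w ∈ Y
          w∈Y = ∈-filter⁺ (counted? (+ m) n) (rsk∈allArrays w size≡) (counted-rsk w w<n size≡ wt≡)
          j : Fin (length Y)
          j = index w∈Y
          pp : IsPlanePartition (y j)
          pp = proj₁ (counted-y j)
          w↭ : w ↭ rsk⁻¹ (y j)
          w↭ = rsk-injective w<n (bounded-rsk⁻¹ (y j) pp) (trans (lookup-index w∈Y) (sym (rsk-rsk⁻¹ (y j) pp)))

        lower-φ : ∀ w → lower φ w ≡ 0ℤ
        lower-φ w with total deg w ℤ.≟ + n | total wt w ℤ.≟ + m
        ... | no ≢n | _ = eigen-zero deg (+ n)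
                (der-eigen _ _ deg _ (+ n) 0ℤ (ℤP.+-identityʳ (+ n)) lower-deg deg-φ) w ≢n
        ... | yes _ | no ≢m = eigen-zero wt (+ m)
                (der-eigen _ _ wt _ (+ m) (+ 2) refl lower-wt wt-φ) w ≢m
        ... | yes deg≡ | yes wt≡ =
                lower-φ-weight-m w (ℤP.+-injective (trans (sym (total-deg w)) deg≡)) wt≡

        -- The indicators are dual to the representatives `rsk⁻¹ (x i)`, so `φ` remembers every
        -- coefficient of the relation.
        φ-rsk⁻¹ : ∀ i → φ (rsk⁻¹ (x i)) ≡ c i
        φ-rsk⁻¹ i = sum-single (λ k → c k * indicator (x k) (rsk⁻¹ (x i))) i (c i)
          (trans (cong (c i *_) (indicator-1 (x i) (rsk⁻¹ (x i)) (represents-rsk⁻¹ (x i) (counted-x i)))) (ℤP.*-identityʳ (c i)))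
          λ k k≢i → trans (cong (c k *_) (indicator-0 (x k) (rsk⁻¹ (x i)) λ (_ , rsk≡) → k≢i (x-injective
              (trans (sym rsk≡) (rsk-rsk⁻¹ (x i) (proj₁ (counted-x i)))))))
            (ℤP.*-zeroʳ (c k))

    b₀-step : b₀ (+ (m ℕ.+ 2)) n ℕ.≤ b₀ (+ m) n
    b₀-step = ℕP.≮⇒≥ λ Y<X → let c , (i , ci≢0) , cv≡0 = dependent Y<X v in
      ci≢0 (trans (sym (φ-rsk⁻¹ c cv≡0 i))
        -- The weight `m + 2` is `suc h` with `h = suc m`, hence positive.
        (lower-injective {suc m} {n} {φ c cv≡0} (subst (λ h → Eigen wt (+ h) (φ c cv≡0)) (ℕP.+-comm m 2) (wt-φ c cv≡0))
          (deg-φ c cv≡0) (lower-φ c cv≡0) (rsk⁻¹ (x i))))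

open import Data.Nat using (_+_; _≤_)
open import Data.Integer using (+_)

theorem2p7 : (m n : ℕ) → b₀ (+ (m + 2)) n ≤ b₀ (+ m) n
theorem2p7 = b₀-step
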